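{- Let $\hat V$ be an $\omega$-nonstandard model of $ZFC^-$, and let $\kappa$ be an infinite regular cardinal with $\kappa<\min(\mathfrak{p}_{\hat V}^+,\mathfrak{t}_{\hat V})$. Then there is a unique regular cardinal $\lambda$ with $(\kappa,\lambda)\in\mathcal{C}_{\hat V}$; moreover this same $\lambda$ is the unique regular cardinal with $(\lambda,\kappa)\in\mathcal{C}_{\hat V}$.
   Context: $ZFC^-$ denotes $ZFC$ without the powerset axiom, with replacement strengthened to collection and choice strengthened to the well-ordering principle. For a model $\hat V \models ZFC^-$, write $\hat\omega$ for $\omega^{\hat V}$ and $\hat<$ for its order. $\hat V$ is $\omega$-nonstandard if $\hat\omega \neq \omega$. For infinite regular cardinals $\kappa,\theta$, a $(\kappa,\theta)$-cut in a linear order $(L,<)$ is a pair of sequences $(a_\alpha:\alpha<\kappa)$ strictly increasing and $(b_\beta:\beta<\theta)$ strictly decreasing with $a_\alpha<b_\beta$ for all $\alpha,\beta$, such that no $c\in L$ satisfies $a_\alpha<c<b_\beta$ for all $\alpha,\beta$. $\mathcal{C}_{\hat V}$ is the set of pairs $(\kappa,\theta)$ of infinite regular cardinals such that $(\hat\omega,\hat<)$ admits a $(\kappa,\theta)$-cut, and $\mathfrak{p}_{\hat V}=\min\{\kappa+\theta:(\kappa,\theta)\in\mathcal{C}_{\hat V}\}$. A tree is a partial order with meets and a minimum element in which the predecessors of each element are linearly ordered; $\mathrm{tree\text{ - }tops}(T)$ is the least cardinal $\kappa$ such that there is a strictly increasing sequence $(s_\alpha:\alpha<\kappa)$ in $T$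 with no upper bound in $T$. $\mathfrak{t}_{\hat V}$ is the minimum over all $\hat n\in\hat\omega$ of $\mathrm{tree\text{ - }tops}$ of the (external) tree $(\hat n^{<\hat n},\subsetneq)$ of sequences (in $\hat V$) from $\hat n$ of $\hat V$-length less than $\hat n$, ordered by proper initial segment. -}

module Defs where

open import Level using (Level; Setω; suc; _⊔_)
open import Axiom.ExcludedMiddle using (ExcludedMiddle)
open import Axiom.Extensionality.Propositional using (Extensionality)
open import Data.Fin.Base using (Fin)
open import Data.Nat.Base as ℕ using (ℕ)
open import Data.Product.Base using (Σ-syntax; ∃; ∃-syntax; _×_; proj₁)
open import Data.Sum.Base using (_⊎_)
open import Data.Vec.Base using (Vec; _∷_; lookup)
open import Function.Base using (id; _∘_)
open import Function.Bundles using (_⇔_; _↣_; _↔_; mk⇔)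
open import Function.Definitions using (Injective)
open import Induction.WellFounded using (WellFounded)
open import Relation.Binary.Bundles using (Poset)
open import Relation.Binary.Core using (Rel)
open import Relation.Binary.Structures using (IsStrictTotalOrder)
open import Relation.Binary.PropositionalEquality
  using (_≡_; refl; isEquivalence)
import Relation.Binary.Construct.NonStrictToStrict as ToStrict
import Relation.Binary.Construct.On as On
open import Relation.Nullary.Negation.Core using (¬_)

-- The metatheory is classical set theory (ZFC).  `ExcludedMiddle` decides
-- every type, not only propositions, so it also provides choice functions;
-- function extensionality makes them independent of how a (Bool-valued)
-- subset is presented, as set-theoretic choice requires.
-- The level arguments are quantified, so each hypothesis lives in Setω.
EM : Setω
EM = ∀ {a : Level} → ExcludedMiddle a

FunExt : Setω
FunExt = ∀ {a b : Level} → Extensionality a b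

------------------------------------------------------------------------
-- Cardinals

-- A cardinal is an initial ordinal: a well-order that does not inject into
-- any of its proper initial segments.  (The segment is not formed as a
-- Σ-type because _<_ need not be proof-irrelevant.)
record Cardinal (ℓ : Level) : Set (suc ℓ) where
  field
    Carrier            : Set ℓ
    _<_                : Rel Carrier ℓ
    isStrictTotalOrder : IsStrictTotalOrder _≡_ _<_
    wellFounded        : WellFounded _<_
    initial            : ∀ a (f : Carrier → Carrier) →
                         Injective _≡_ _≡_ f → ¬ (∀ x → f x < a)

module _ {ℓ : Level} where

  infix 4 _≤ᶜ_ _<ᶜ_ _≈ᶜ_

  _≤ᶜ_ _<ᶜ_ _≈ᶜ_ : Rel (Cardinal ℓ) ℓ
  κ ≤ᶜ μ = Cardinal.Carrier κ ↣ Cardinal.Carrier μ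
  κ <ᶜ μ = κ ≤ᶜ μ × ¬ (μ ≤ᶜ κ)
  κ ≈ᶜ μ = Cardinal.Carrier κ ↔ Cardinal.Carrier μ

  Infinite : Cardinal ℓ → Set ℓ
  Infinite κ = ℕ ↣ Cardinal.Carrier κ

  -- Every function from a proper initial segment of κ into κ is bounded.
  -- Such functions are given by total functions, used below a only.
  Regular : Cardinal ℓ → Set ℓ
  Regular κ = ∀ (a : Carrier) (f : Carrier → Carrier) →
              ∃[ c ] (∀ b → b < a → f b < c)
    where open Cardinal κ

  InfiniteRegular : Cardinal ℓ → Set ℓ
  InfiniteRegular κ = Infinite κ × Regular κ

  -- μ = κ + θ
  IsSum : Cardinal ℓ → Cardinal ℓ → Cardinal ℓ → Set ℓ
  IsSum κ θ μ =
    Cardinal.Carrier μ ↔ (Cardinal.Carrier κ ⊎ Cardinal.Carrier θ)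

  IsLeast : ∀ {p} → (Cardinal ℓ → Set p) → Cardinal ℓ → Set (suc ℓ ⊔ p)
  IsLeast P μ = P μ × (∀ ν → P ν → μ ≤ᶜ ν)

  IsSuccessor : Cardinal ℓ → Cardinal ℓ → Set (suc ℓ)
  IsSuccessor μ = IsLeast (μ <ᶜ_)

------------------------------------------------------------------------
-- Cuts and tree-tops

record Cut {ℓ} {L : Set ℓ} (_<ᴸ_ : Rel L ℓ) (κ θ : Cardinal ℓ) : Set ℓ where
  private
    module κ = Cardinal κ
    module θ = Cardinal θ
  field
    lower      : κ.Carrier → L
    upper      : θ.Carrier → L
    increasing : ∀ {α α′} → α κ.< α′ → lower α <ᴸ lower α′
    decreasing : ∀ {β β′} → β θ.< β′ → upper β′ <ᴸ upper β
    separated  : ∀ α β → lower α <ᴸ upper β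
    unfilled   : ¬ (∃[ c ] (∀ α β → (lower α <ᴸ c) × (c <ᴸ upper β)))

module _ {ℓ} (T : Poset ℓ ℓ ℓ) where
  private
    module T = Poset T

  open ToStrict T._≈_ T._≤_ using () renaming (_<_ to _<ᵀ_)

  HasUnboundedSequence : Cardinal ℓ → Set ℓ
  HasUnboundedSequence κ =
    Σ[ s ∈ (Carrier → T.Carrier) ]
      (∀ {α β} → α < β → s α <ᵀ s β) × ¬ (∃[ u ] (∀ α → s α T.≤ u))
    where open Cardinal κ

  -- μ = tree-tops T; there is no such μ if every strictly increasing
  -- sequence in T is bounded.
  IsTreeTops : Cardinal ℓ → Set (suc ℓ)
  IsTreeTops = IsLeast HasUnboundedSequence

------------------------------------------------------------------------
-- The language of set theory, with de Bruijn variables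

infix  8 _∈̇_ _≐_
infix  7 ¬̇_ ∀̇_ ∃̇_
infixr 6 _∧̇_
infixr 5 _∨̇_
infixr 4 _⇒̇_

data Formula (n : ℕ) : Set where
  _∈̇_ _≐_        : Fin n → Fin n → Formula n
  ¬̇_             : Formula n → Formula n
  _∧̇_ _∨̇_ _⇒̇_    : Formula n → Formula n → Formula n
  ∀̇_ ∃̇_          : Formula (ℕ.suc n) → Formula n

module SetTheory {ℓ} {M : Set ℓ} (_∈_ : Rel M ℓ) where

  Sat : ∀ {n} → Formula n → Vec M n → Set ℓ
  Sat (i ∈̇ j) ρ = lookup ρ i ∈ lookup ρ j
  Sat (i ≐ j) ρ = lookup ρ i ≡ lookup ρ j
  Sat (¬̇ φ)   ρ = ¬ Sat φ ρ
  Sat (φ ∧̇ ψ) ρ = Sat φ ρ × Sat ψ ρ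
  Sat (φ ∨̇ ψ) ρ = Sat φ ρ ⊎ Sat ψ ρ
  Sat (φ ⇒̇ ψ) ρ = Sat φ ρ → Sat ψ ρ
  Sat (∀̇ φ)   ρ = ∀ x → Sat φ (x ∷ ρ)
  Sat (∃̇ φ)   ρ = ∃[ x ] Sat φ (x ∷ ρ)

  infix 4 _⊆_

  _⊆_ : Rel M ℓ
  x ⊆ y = ∀ z → z ∈ x → z ∈ y

  IsEmpty : M → Set ℓ
  IsEmpty x = ∀ z → ¬ (z ∈ x)

  -- u = {x , y}
  IsPair : M → M → M → Set ℓ
  IsPair u x y = ∀ z → z ∈ u ⇔ (z ≡ x ⊎ z ≡ y)

  -- p = {{x , x} , {x , y}}
  IsOrderedPair : M → M → M → Set ℓ
  IsOrderedPair p x y =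
    ∃[ u ] ∃[ v ] IsPair u x x × IsPair v x y × IsPair p u v

  -- ⟨x , y⟩ ∈ r
  Related : M → M → M → Set ℓ
  Related r x y = ∃[ p ] IsOrderedPair p x y × p ∈ r

  -- f : a → b
  IsFunction : M → M → M → Set ℓ
  IsFunction f a b =
    (∀ p → p ∈ f → ∃[ x ] ∃[ y ] x ∈ a × y ∈ b × IsOrderedPair p x y) ×
    (∀ x → x ∈ a → ∃[ y ] Related f x y × (∀ y′ → Related f x y′ → y′ ≡ y))

  -- r is a strict well-ordering of a.
  WellOrders : M → M → Set ℓ
  WellOrders r a =
    (∀ x → x ∈ a → ¬ Related r x x) ×
    (∀ x y z → x ∈ a → y ∈ a → z ∈ a →
       Related r x y → Related r y z → Related r x z) ×
    (∀ x y → x ∈ a → y ∈ a → Related r x y ⊎ x ≡ y ⊎ Related r y x) ×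
    (∀ b → b ⊆ a → ¬ IsEmpty b →
       ∃[ x ] x ∈ b × (∀ y → y ∈ b → ¬ Related r y x))

  -- y = x ∪ {x}
  IsSuc : M → M → Set ℓ
  IsSuc x y = ∀ z → z ∈ y ⇔ (z ∈ x ⊎ z ≡ x)

  Inductive : M → Set ℓ
  Inductive w =
    (∃[ e ] IsEmpty e × e ∈ w) ×
    (∀ x → x ∈ w → ∃[ y ] IsSuc x y × y ∈ w)

  -- n ∈ ω̂, where ω̂ is the intersection of all inductive sets.
  IsNat : M → Set ℓ
  IsNat n = ∀ w → Inductive w → n ∈ w

  -- The elements of ω̂ that correspond to a natural number of the metatheory.
  data Standard : M → Set ℓ where
    standard-zero : ∀ {x} → IsEmpty x → Standard x
    standard-suc  : ∀ {x y} → Standard x → IsSuc x y → Standard y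

record ModelZFC⁻ (ℓ : Level) : Set (suc ℓ) where
  infix 4 _∈_
  field
    M   : Set ℓ
    _∈_ : Rel M ℓ

  open SetTheory _∈_ public

  field
    extensionality : ∀ x y → (∀ z → z ∈ x ⇔ z ∈ y) → x ≡ y
    foundation     : ∀ a → ¬ IsEmpty a →
                     ∃[ x ] x ∈ a × (∀ y → y ∈ a → ¬ (y ∈ x))
    pairing        : ∀ x y → ∃[ u ] IsPair u x y
    union          : ∀ a → ∃[ u ] (∀ z → z ∈ u ⇔ (∃[ y ] y ∈ a × z ∈ y))
    infinity       : ∃[ w ] Inductive w
    separation     : ∀ {n} (φ : Formula (ℕ.suc n)) (ρ : Vec M n) a →
                     ∃[ b ] (∀ z → z ∈ b ⇔ (z ∈ a × Sat φ (z ∷ ρ)))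
    -- In φ, variable 0 is the value y and variable 1 is the argument x.
    collection     : ∀ {n} (φ : Formula (ℕ.suc (ℕ.suc n))) (ρ : Vec M n) a →
                     (∀ x → x ∈ a → ∃[ y ] Sat φ (y ∷ x ∷ ρ)) →
                     ∃[ b ] (∀ x → x ∈ a → ∃[ y ] y ∈ b × Sat φ (y ∷ x ∷ ρ))
    wellOrdering   : ∀ a → ∃[ r ] WellOrders r a

  inclusion : Poset ℓ ℓ ℓ
  inclusion = record
    { Carrier = M
    ; _≈_ = _≡_
    ; _≤_ = _⊆_
    ; isPartialOrder = record
      { isPreorder = record
        { isEquivalence = isEquivalence
        ; reflexive     = λ { refl _ → id }
        ; trans         = λ x⊆y y⊆z w → y⊆z w ∘ x⊆y w
        }
      ; antisym = λ {x} {y} x⊆y y⊆x →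
          extensionality x y (λ z → mk⇔ (x⊆y z) (y⊆x z))
      }
    }

  -- As ω̂ always contains the standard numbers, ω̂ ≠ ω says that it contains
  -- something else.
  ωNonstandard : Set ℓ
  ωNonstandard = ¬ (∀ n → IsNat n → Standard n)

  ω̂ : Set ℓ
  ω̂ = ∃ IsNat

  _<̂_ : Rel ω̂ ℓ
  m <̂ n = proj₁ m ∈ proj₁ n

  -- (κ , θ) ∈ 𝒞
  𝒞 : Cardinal ℓ → Cardinal ℓ → Set ℓ
  𝒞 κ θ = InfiniteRegular κ × InfiniteRegular θ × Cut _<̂_ κ θ

  Is𝔭 : Cardinal ℓ → Set (suc ℓ)
  Is𝔭 = IsLeast (λ μ → ∃[ κ ] ∃[ θ ] 𝒞 κ θ × IsSum κ θ μ)

  -- n̂^{<n̂}.  Its strict order, ⊊ on graphs, is proper initial segment.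
  SequenceTree : M → Poset ℓ ℓ ℓ
  SequenceTree n =
    On.poset {B = ∃[ s ] ∃[ k ] k ∈ n × IsFunction s k n} inclusion proj₁

  -- 0^{<0} is empty, hence not a tree (it has no minimum), and is left out:
  -- it would make 𝔱 equal to 0.
  Is𝔱 : Cardinal ℓ → Set (suc ℓ)
  Is𝔱 = IsLeast (λ μ → ∃[ n ] IsNat n × ¬ IsEmpty n ×
                         IsTreeTops (SequenceTree n) μ)

module Submission where

-- Given two increasing κ-sequences (a_α) and (a′_α) that are bounded in ω̂,
-- recursion along κ builds a chain of monotone internal functions s_α with
-- domain a_α + 1 and s_α(a_α) = a′_α: at stage α, an upper bound of the earlier
-- ones in n^{<n}, which exists since κ < 𝔱, is trimmed to where it is monotone
-- with arguments below a_α and values at most a′_α, and then continued with the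
-- constant value a′_α.  An upper bound f of the whole chain takes each a_α to
-- a′_α, so x ↦ f(x) and y ↦ max {x | f(x) ≤ y} carry upper bounds of one
-- sequence to upper bounds of the other.  Hence their coinitialities agree, and
-- being regular they are equinumerous.
--
-- Since κ is regular and κ ≤ 𝔭 = κ₀ + θ₀ for some (κ₀, θ₀)-cut, κ embeds in κ₀
-- or in θ₀; a decreasing function n → n in V̂ reflects cuts and makes the two
-- cases alike.  A bounded increasing κ-sequence gives a (κ, θ)-cut, with θ the
-- coinitiality of its upper bounds, and reflection also gives the claims about
-- (θ, κ)-cuts.

open import Defs
open import Axiom.UniquenessOfIdentityProofs using (module Decidable⇒UIP)
open import Data.Bool.Base using (Bool; true; false)
open import Data.Bool.Properties using (_≟_)
open import Data.Empty using (⊥-elim)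
open import Data.Fin.Base using (Fin; suc)
open import Data.Fin.Patterns using (0F; 1F; 2F; 3F; 4F; 5F; 6F; 7F)
open import Data.Nat.Base as ℕ using (ℕ)
import Data.Nat.Properties as ℕₚ
open import Data.Product.Base using (Σ-syntax; ∃; ∃-syntax; _×_; _,_; proj₁; proj₂)
open import Data.Sum.Base as Sum using (_⊎_; inj₁; inj₂; [_,_]′)
open import Data.Sum.Properties using (inj₁-injective)
open import Data.Unit.Polymorphic.Base using (⊤; tt)
open import Data.Vec.Base using (Vec; []; _∷_; lookup)
open import Function.Base using (_∘_; id; _on_; case_of_)
open import Function.Bundles using (_⇔_; _↣_; mk⇔; mk↣; mk↔ₛ′; Equivalence; Injection)
open import Function.Construct.Composition using (_↣-∘_)
open import Function.Definitions using (Injective)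
open import Function.Properties.Inverse using (↔⇒↣; ↔-sym)
open import Induction.WellFounded as WF using (WellFounded; Acc; acc; WfRec)
open import Level using (Level; Lift; lift; lower) renaming (suc to lsuc)
open import Relation.Binary.Bundles using (Poset)
import Relation.Binary.Construct.Flip.EqAndOrd as Flip
import Relation.Binary.Construct.NonStrictToStrict as ToStrict
import Relation.Binary.Construct.On as On
open import Relation.Binary.Core using (Rel)
open import Relation.Binary.Definitions using (Trichotomous; tri<; tri≈; tri>)
open import Relation.Binary.PropositionalEquality
  using (_≡_; refl; sym; trans; cong; subst; subst₂; resp₂; isEquivalence)
open import Relation.Binary.Structures using (IsStrictTotalOrder)
open import Relation.Nullary.Decidable using (yes; no; decidable-stable; toSum)
open import Relation.Nullary.Negation using (¬_; contradiction)

-- Classical choice, subsets and recursion on well-orders.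

module Classical (em : EM) (fe : FunExt) where

  private
    variable
      a p : Level

  ¬¬-elim : {P : Set p} → ¬ ¬ P → P
  ¬¬-elim = decidable-stable em

  ¬∀⇒∃¬ : {A : Set a} {P : A → Set p} → ¬ (∀ x → P x) → ∃[ x ] ¬ P x
  ¬∀⇒∃¬ ¬∀ = ¬¬-elim λ ¬∃ → ¬∀ λ x → ¬¬-elim λ ¬Px → ¬∃ (x , ¬Px)

  -- Bool-valued subsets do not raise the universe level, so families of subsets can be quantified
  -- over at the level of the underlying set. Excluded middle turns any predicate, at any level,
  -- into such a subset.
  ⟦_⟧ : {A : Set a} → (A → Set p) → A → Bool
  ⟦ P ⟧ x with em {P = P x}
  ... | yes _ = true
  ... | no  _ = false

  ∋-intro : ∀ {A : Set a} {P : A → Set p} {x} → P x → ⟦ P ⟧ x ≡ true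
  ∋-intro {P = P} {x} Px with em {P = P x}
  ... | yes _  = refl
  ... | no ¬Px = contradiction Px ¬Px

  ∋-elim : ∀ {A : Set a} {P : A → Set p} {x} → ⟦ P ⟧ x ≡ true → P x
  ∋-elim {P = P} {x} eq with em {P = P x}
  ∋-elim eq | yes Px = Px
  ∋-elim () | no  _

  -- Well-orders

  record WellOrder (ℓ : Level) : Set (lsuc ℓ) where
    infix 4 _<_
    field
      Carrier            : Set ℓ
      _<_                : Rel Carrier ℓ
      isStrictTotalOrder : IsStrictTotalOrder _≡_ _<_
      wellFounded        : WellFounded _<_

    open IsStrictTotalOrder isStrictTotalOrder public
      using (compare) renaming (trans to <-trans)

    <-irrefl : ∀ {x} → ¬ (x < x)
    <-irrefl = IsStrictTotalOrder.irrefl isStrictTotalOrder refl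

    <-≮-trans : ∀ {x y z} → x < y → ¬ (z < y) → x < z
    <-≮-trans {y = y} {z} x<y z≮y with compare y z
    ... | tri< y<z _ _  = <-trans x<y y<z
    ... | tri≈ _ refl _ = x<y
    ... | tri> _ _ z<y  = contradiction z<y z≮y

    minimal : (P : Carrier → Set p) → ∃ P →
              ∃[ x ] P x × (∀ y → y < x → ¬ P y)
    minimal P (x , Px) = go x (wellFounded x) Px
      where
      go : ∀ x → Acc _<_ x → P x → ∃[ x ] P x × (∀ y → y < x → ¬ P y)
      go x (acc rs) Px with em {P = ∃[ y ] y < x × P y}
      ... | yes (y , y<x , Py) = go y (rs y<x) Py
      ... | no  none           = x , Px , λ y y<x Py → none (y , y<x , Py)

    induction : (P : Carrier → Set p) → (∀ x → (∀ y → y < x → P y) → P x) → ∀ x → P x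
    induction P step = WF.All.wfRec wellFounded _ P (λ x IH → step x λ _ → IH)

    abstract
      -- Each value is chosen among those related to the earlier values, with the first argument as
      -- default if there are none. The specification is conditional because existence may rest on
      -- invariants of the earlier values, to be established by a separate induction.
      recursion : {X : Set a} → X →
                  (R : ∀ x → (∀ y → y < x → X) → X → Set p) →
                  Σ[ f ∈ (Carrier → X) ]
                    ∀ x → ∃ (R x (λ y _ → f y)) → R x (λ y _ → f y) (f x)
      recursion {X = X} x₀ R = f , λ x ex →
        subst (R x _) (sym unfold) (choose-spec x _ ex)
        where
        choose : ∀ x → (∀ y → y < x → X) → X
        choose x prev with em {P = ∃ (R x prev)}
        ... | yes (v , _) = v
        ... | no  _       = x₀

        choose-spec : ∀ x prev → ∃ (R x prev) → R x prev (choose x prev)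
        choose-spec x prev ex with em {P = ∃ (R x prev)}
        ... | yes (_ , Rv) = Rv
        ... | no  ∄        = contradiction ex ∄

        step : ∀ x → WfRec _<_ (λ _ → X) x → X
        step x IH = choose x (λ y → IH {y})

        f : Carrier → X
        f = WF.All.wfRec wellFounded _ (λ _ → X) step

        unfold : ∀ {x} → f x ≡ choose x (λ y _ → f y)
        unfold = WF.FixPoint.unfold-wfRec wellFounded (λ _ → X) step
          λ x eq → cong (choose x) (fe λ y → fe eq)

    Increasing : {X : Set a} → Rel X p → (Carrier → X) → Set _
    Increasing _≺_ f = ∀ {x y} → x < y → f x ≺ f y

    -- Monotonicity is assumed only below points of `D`, so that this applies in the middle of a
    -- recursion, when only the stages before some α are known to form a chain.
    monotone⇒comparable : {X : Set a} (_≼_ : Rel X p) → (∀ {x} → x ≼ x) →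
      {D : Carrier → Set p} {f : Carrier → X} → (∀ {x y} → D y → x < y → f x ≼ f y) →
      ∀ {x y} → D x → D y → f x ≼ f y ⊎ f y ≼ f x
    monotone⇒comparable _≼_ refl′ mono {x} {y} Dx Dy with compare x y
    ... | tri< x<y _ _  = inj₁ (mono Dy x<y)
    ... | tri≈ _ refl _ = inj₁ refl′
    ... | tri> _ _ y<x  = inj₂ (mono Dx y<x)

    increasing⇒injective : {X : Set a} (_≺_ : Rel X p) → (∀ {x} → ¬ (x ≺ x)) →
                           {f : Carrier → X} → Increasing _≺_ f → Injective _≡_ _≡_ f
    increasing⇒injective _≺_ irr {f} inc {x} {y} fx≡fy with compare x y
    ... | tri< x<y _ _ = contradiction (subst (_≺ f y) fx≡fy (inc x<y)) irr
    ... | tri≈ _ x≡y _ = x≡y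
    ... | tri> _ _ y<x = contradiction (subst (f y ≺_) fx≡fy (inc y<x)) irr

  -- Comparison of well-orders.

  module _ {ℓ : Level} (A B : WellOrder ℓ) where
    private
      module A = WellOrder A
      module B = WellOrder B

    InitialEmbedding : Set ℓ
    InitialEmbedding = Σ[ e ∈ (A.Carrier → B.Carrier) ]
      A.Increasing B._<_ e × (∀ x y → y B.< e x → ∃[ x′ ] e x′ ≡ y)

    Covered : Set ℓ
    Covered = ∃[ a ] Σ[ e ∈ (A.Carrier → B.Carrier) ]
      (∀ y → ∃[ x ] x A.< a × e x ≡ y)

    -- e sends x to the least strict upper bound of its previous values.
    comparison : B.Carrier → InitialEmbedding ⊎ Covered
    comparison b₀ = result
      where
      Above : (A.Carrier → B.Carrier) → A.Carrier → B.Carrier → Set ℓ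
      Above e x y = ∀ x′ → x′ A.< x → e x′ B.< y

      rec = A.recursion b₀ λ x prev y →
        (∀ x′ (x′<x : x′ A.< x) → prev x′ x′<x B.< y) ×
        (∀ y′ → y′ B.< y → ¬ (∀ x′ (x′<x : x′ A.< x) → prev x′ x′<x B.< y′))
      e = proj₁ rec

      spec : ∀ x → ∃ (Above e x) →
             Above e x (e x) × (∀ y′ → y′ B.< e x → ¬ Above e x y′)
      spec x ex = proj₂ rec x (B.minimal (Above e x) ex)

      -- Some earlier value is at least y. If it equals y, this is the preimage; if it overshoots y,
      -- leastness of that value means that y already failed to bound the values before it, and the
      -- induction hypothesis applies there.
      hit : ∀ x → (∀ x′ → x′ A.< x → ∃ (Above e x′)) →
            ∀ y → ¬ Above e x y → ∃[ x′ ] x′ A.< x × e x′ ≡ y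
      hit = A.induction _ λ x IH ok y ¬above →
        let x′ , ¬lt = ¬∀⇒∃¬ ¬above
            x′<x , ex′≮y = ¬∀⇒∃¬ {P = λ _ → e x′ B.< y} ¬lt
        in case B.compare (e x′) y of λ where
          (tri< lt _ _) → contradiction lt ex′≮y
          (tri≈ _ eq _) → x′ , x′<x , eq
          (tri> _ _ gt) →
            let x″ , x″<x′ , eq = IH x′ x′<x
                  (λ z z<x′ → ok z (A.<-trans z<x′ x′<x)) y
                  (proj₂ (spec x′ (ok x′ x′<x)) y gt)
            in x″ , A.<-trans x″<x′ x′<x , eq

      result : InitialEmbedding ⊎ Covered
      result with em {P = ∀ x → ∃ (Above e x)}
      ... | yes ok = inj₁ (e , (λ {x} {y} x<y → proj₁ (spec y (ok y)) x x<y) ,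
              λ x y y<ex → let x′ , _ , eq = hit x (λ z _ → ok z) y
                                             (proj₂ (spec x (ok x)) y y<ex)
                           in x′ , eq)
      -- At the first a whose earlier values have no strict upper bound, no y bounds them strictly,
      -- so `hit` finds every y among them.
      ... | no ¬ok =
        let a , ∄ , below = A.minimal _ (¬∀⇒∃¬ ¬ok)
        in inj₂ (a , e , λ y → hit a (λ x x<a → ¬¬-elim (below x x<a)) y
                                    λ above → ∄ (y , above))

    covered⇒bounded : ((a , _) : Covered) →
                      Σ[ h ∈ (B.Carrier → A.Carrier) ]
                        Injective _≡_ _≡_ h × (∀ y → h y A.< a)
    covered⇒bounded (a , e , cover) =
      (λ y → proj₁ (cover y)) ,
      (λ {y} {y′} eq → trans (sym (proj₂ (proj₂ (cover y))))
                             (trans (cong e eq) (proj₂ (proj₂ (cover y′))))) ,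
      λ y → proj₁ (proj₂ (cover y))

  -- Zermelo's theorem: the stages built up by successively adding chosen new
  -- elements are linearly ordered by inclusion, and every element is the one
  -- added to the largest stage that omits it.
  module Zermelo {ℓ : Level} (X : Set ℓ) (x₀ : X) where

    Subset : Set ℓ
    Subset = X → Bool

    infix 4 _∋_ _⊑_

    _∋_ : Subset → X → Set
    S ∋ x = S x ≡ true

    _⊑_ : Subset → Subset → Set ℓ
    S ⊑ S′ = ∀ {x} → S ∋ x → S′ ∋ x

    ⊑-antisym : ∀ {S S′} → S ⊑ S′ → S′ ⊑ S → S ≡ S′
    ⊑-antisym {S} {S′} S⊑S′ S′⊑S = fe λ x → bool-ext (S x) (S′ x) S⊑S′ S′⊑S
      where
      bool-ext : ∀ b c → (b ≡ true → c ≡ true) → (c ≡ true → b ≡ true) → b ≡ c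
      bool-ext true  c     f g = sym (f refl)
      bool-ext false true  f g = g refl
      bool-ext false false f g = refl

    new : Subset → X
    new S with em {P = ∃[ x ] ¬ S ∋ x}
    ... | yes (x , _) = x
    ... | no  _       = x₀

    new-∉ : ∀ {S x} → ¬ S ∋ x → ¬ S ∋ new S
    new-∉ {S} {x} x∉S with em {P = ∃[ x ] ¬ S ∋ x}
    ... | yes (_ , y∉S) = y∉S
    ... | no  none      = contradiction (x , x∉S) none

    _⁺ : Subset → Subset
    S ⁺ = ⟦ (λ x → S ∋ x ⊎ x ≡ new S) ⟧

    ⋃ : (Subset → Bool) → Subset
    ⋃ F = ⟦ (λ x → ∃[ S ] F S ≡ true × S ∋ x) ⟧

    data Stage : Subset → Set ℓ where
      next  : ∀ {S} → Stage S → Stage (S ⁺)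
      limit : ∀ F → (∀ S → F S ≡ true → Stage S) → Stage (⋃ F)

    ⊑⁺ : ∀ {S} → S ⊑ S ⁺
    ⊑⁺ x∈S = ∋-intro (inj₁ x∈S)

    new∈⁺ : ∀ {S} → S ⁺ ∋ new S
    new∈⁺ = ∋-intro (inj₂ refl)

    -- Double induction as in the Bourbaki-Witt theorem: `linear` recurses on the first stage, and
    -- `linear′` on the second while a stage T comparable with all others is held fixed. Stating the
    -- second alternative with the successor stage records that nothing lies strictly between a
    -- stage and its successor.
    linear : ∀ {S S′} → Stage S → Stage S′ → S ⊑ S′ ⊎ S′ ⁺ ⊑ S
    linear′ : ∀ {T} → Stage T → (∀ {S′} → Stage S′ → T ⊑ S′ ⊎ S′ ⁺ ⊑ T) →
              ∀ {S} → Stage S → S ⊑ T ⊎ T ⁺ ⊑ S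

    linear (next s) s′ with linear s s′
    ... | inj₂ S′⁺⊑T = inj₂ (⊑⁺ ∘ S′⁺⊑T)
    ... | inj₁ T⊑S′ with linear′ s (linear s) s′
    ...   | inj₂ T⁺⊑S′ = inj₁ T⁺⊑S′
    ...   | inj₁ S′⊑T  = inj₂ (subst (λ S → S ⁺ ⊑ _) (⊑-antisym T⊑S′ S′⊑T) id)
    linear {S′ = S′} (limit F st) s′ with em {P = ∃[ S ] F S ≡ true × ¬ (S ⊑ S′)}
    ... | no none = inj₁ λ {x} x∈⋃ → let S , S∈F , x∈S = ∋-elim x∈⋃ in
            ¬¬-elim (λ x∉S′ → none (S , S∈F , λ S⊑S′ → x∉S′ (S⊑S′ x∈S)))
    ... | yes (S , S∈F , S⋢S′) with linear (st S S∈F) s′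
    ...   | inj₁ S⊑S′  = contradiction (λ {_} → S⊑S′) S⋢S′
    ...   | inj₂ S′⁺⊑S = inj₂ λ x∈ → ∋-intro (S , S∈F , S′⁺⊑S x∈)

    linear′ t lin (next r) with linear′ t lin r
    ... | inj₂ T⁺⊑R = inj₂ (⊑⁺ ∘ T⁺⊑R)
    ... | inj₁ R⊑T with lin r
    ...   | inj₂ R⁺⊑T = inj₁ R⁺⊑T
    ...   | inj₁ T⊑R  = inj₂ (subst (λ S → S ⁺ ⊑ _) (⊑-antisym R⊑T T⊑R) id)
    linear′ {T} t lin (limit F st) with em {P = ∃[ S ] F S ≡ true × ¬ (S ⊑ T)}
    ... | no none = inj₁ λ {x} x∈⋃ → let S , S∈F , x∈S = ∋-elim x∈⋃ in
            ¬¬-elim (λ x∉T → none (S , S∈F , λ S⊑T → x∉T (S⊑T x∈S)))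
    ... | yes (S , S∈F , S⋢T) with linear′ t lin (st S S∈F)
    ...   | inj₁ S⊑T  = contradiction (λ {_} → S⊑T) S⋢T
    ...   | inj₂ T⁺⊑S = inj₂ λ x∈ → ∋-intro (S , S∈F , T⁺⊑S x∈)

    StageWithout : X → Subset → Set ℓ
    StageWithout x S = Stage S × ¬ S ∋ x

    before : X → Subset
    before x = ⋃ ⟦ StageWithout x ⟧

    before-stage : ∀ x → Stage (before x)
    before-stage x = limit ⟦ StageWithout x ⟧ λ S → proj₁ ∘ ∋-elim

    before-∌ : ∀ x → ¬ before x ∋ x
    before-∌ x x∈ = let S , S∈F , x∈S = ∋-elim x∈ in proj₂ (∋-elim S∈F) x∈S

    before-max : ∀ {x S} → Stage S → ¬ S ∋ x → S ⊑ before x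
    before-max s x∉S y∈S = ∋-intro (_ , ∋-intro (s , x∉S) , y∈S)

    -- If x were still missing, the successor stage would be contained in `before x` by maximality,
    -- and the element it adds would not be new.
    ∈before⁺ : ∀ x → before x ⁺ ∋ x
    ∈before⁺ x = ¬¬-elim λ x∉ →
      new-∉ {before x} (before-∌ x) (before-max (next (before-stage x)) x∉ new∈⁺)

    new-before : ∀ x → x ≡ new (before x)
    new-before x with ∋-elim (∈before⁺ x)
    ... | inj₁ x∈ = contradiction x∈ (before-∌ x)
    ... | inj₂ eq = eq

    _≺_ : Rel X ℓ
    x ≺ y = Lift ℓ (before y ∋ x)

    ≺-irrefl : ∀ {x} → ¬ (x ≺ x)
    ≺-irrefl (lift x∈) = before-∌ _ x∈

    ≺-trans : ∀ {x y z} → x ≺ y → y ≺ z → x ≺ z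
    ≺-trans {x} {y} {z} (lift x∈) (lift y∈) with linear (before-stage y) (before-stage z)
    ... | inj₁ ⊑z = lift (⊑z x∈)
    ... | inj₂ ⊑y = contradiction (⊑y (⊑⁺ y∈)) (before-∌ y)

    ≺-compare : Trichotomous _≡_ _≺_
    ≺-compare x y with linear (before-stage x) (before-stage y)
    ... | inj₂ y⁺⊑x = tri> (λ x≺y → ≺-irrefl (≺-trans x≺y y≺x))
                           (λ { refl → ≺-irrefl y≺x }) y≺x
      where y≺x = lift (y⁺⊑x (∈before⁺ y))
    ... | inj₁ x⊑y with linear (before-stage y) (before-stage x)
    ...   | inj₂ x⁺⊑y = tri< x≺y (λ { refl → ≺-irrefl x≺y })
                             (λ y≺x → ≺-irrefl (≺-trans x≺y y≺x))
      where x≺y = lift (x⁺⊑y (∈before⁺ x))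
    ...   | inj₁ y⊑x = tri≈ (λ { (lift x∈) → before-∌ x (y⊑x x∈) }) x≡y
                            (λ { (lift y∈) → before-∌ y (x⊑y y∈) })
      where
      x≡y = trans (new-before x)
                  (trans (cong new (⊑-antisym x⊑y y⊑x)) (sym (new-before y)))

    -- Induction on how the stage was built: all predecessors of the element added to T already lie
    -- in T, since otherwise that element would belong to the stage that omits it.
    accessible : ∀ {S} → Stage S → ∀ x → S ∋ x → Acc _≺_ x
    accessible (limit F st) x x∈ =
      let S , S∈F , x∈S = ∋-elim x∈ in accessible (st S S∈F) x x∈S
    accessible (next {T} t) x x∈ with em {P = T ∋ x} | ∋-elim x∈
    ... | yes x∈T | _         = accessible t x x∈T
    ... | no  x∉T | inj₁ x∈T  = contradiction x∈T x∉T
    ... | no  x∉T | inj₂ refl = acc λ {y} (lift y∈) →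
      [ (λ below → accessible t y (below y∈))
      , (λ T⁺⊑ → contradiction (T⁺⊑ new∈⁺) (before-∌ x))
      ]′ (linear (before-stage x) t)

    wellOrder : WellOrder ℓ
    wellOrder = record
      { Carrier            = X
      ; _<_                = _≺_
      ; isStrictTotalOrder = record
        { isStrictPartialOrder = record
          { isEquivalence = isEquivalence
          ; irrefl        = λ { refl → ≺-irrefl }
          ; trans         = ≺-trans
          ; <-resp-≈      = resp₂ _≺_
          }
        ; compare = ≺-compare
        }
      ; wellFounded = λ x → accessible (next (before-stage x)) x (∈before⁺ x)
      }

  -- Cardinals

  module _ {ℓ : Level} where

    wellOrderOf : Cardinal ℓ → WellOrder ℓ
    wellOrderOf κ = record { Cardinal κ }

    element : (κ : Cardinal ℓ) → Infinite κ → Cardinal.Carrier κ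
    element κ inf = Injection.to inf 0

    -- If comparison went the other way, μ would inject into a proper initial segment of κ; composed
    -- with the injection of κ into μ, this contradicts the initiality of κ.
    ≤⇒initialEmbedding : ∀ κ μ → Infinite μ → κ ≤ᶜ μ →
                         InitialEmbedding (wellOrderOf κ) (wellOrderOf μ)
    ≤⇒initialEmbedding κ μ inf κ≤μ
      with comparison (wellOrderOf κ) (wellOrderOf μ) (element μ inf)
    ... | inj₁ e = e
    ... | inj₂ c =
      let h , h-inj , h<a = covered⇒bounded (wellOrderOf κ) (wellOrderOf μ) c
      in ⊥-elim (Cardinal.initial κ (proj₁ c) (h ∘ Injection.to κ≤μ)
                   (Injection.injective κ≤μ ∘ h-inj) (λ x → h<a _))

    initialEmbedding⇒≤ : ∀ κ μ → InitialEmbedding (wellOrderOf κ) (wellOrderOf μ) → κ ≤ᶜ μ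
    initialEmbedding⇒≤ κ μ (e , inc , _) =
      mk↣ (WellOrder.increasing⇒injective (wellOrderOf κ) (Cardinal._<_ μ)
             (WellOrder.<-irrefl (wellOrderOf μ)) inc)

    ≤ᶜ-total : ∀ κ μ → Infinite μ → κ ≤ᶜ μ ⊎ μ ≤ᶜ κ
    ≤ᶜ-total κ μ inf with comparison (wellOrderOf κ) (wellOrderOf μ) (element μ inf)
    ... | inj₁ e = inj₁ (initialEmbedding⇒≤ κ μ e)
    ... | inj₂ c =
      let h , h-inj , _ = covered⇒bounded (wellOrderOf κ) (wellOrderOf μ) c
      in inj₂ (mk↣ h-inj)

    -- Unbounded maps and regular cardinals.

    Unbounded : ∀ {A : Set ℓ} (κ : Cardinal ℓ) → (A → Cardinal.Carrier κ) → Set ℓ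
    Unbounded κ g = ∀ c → ∃[ y ] ¬ (g y < c)
      where open Cardinal κ

    -- Otherwise a proper initial segment of κ covers μ, and composing the cover with `g` gives an
    -- unbounded function on that segment, against regularity.
    regular-unbounded⇒initialEmbedding :
      ∀ κ μ → InfiniteRegular κ → (g : Cardinal.Carrier μ → Cardinal.Carrier κ) → Unbounded κ g →
      InitialEmbedding (wellOrderOf κ) (wellOrderOf μ)
    regular-unbounded⇒initialEmbedding κ μ (inf , reg) g unb
      with comparison (wellOrderOf κ) (wellOrderOf μ) (proj₁ (unb (element κ inf)))
    ... | inj₁ e = e
    ... | inj₂ (a , e , cover) =
      let c , below = reg a (g ∘ e)
          y , gy≮c = unb c
          x , x<a , ex≡y = cover y
      in contradiction (subst (λ z → g z < c) ex≡y (below x x<a)) gy≮c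
      where open Cardinal κ

    -- The range is closed downwards, so if it missed y, it would lie below y; then μ, which injects
    -- into κ, would inject into its own proper segment.
    initialEmbedding-≥⇒≈ : ∀ κ μ → InitialEmbedding (wellOrderOf κ) (wellOrderOf μ) →
                           μ ≤ᶜ κ → κ ≈ᶜ μ
    initialEmbedding-≥⇒≈ κ μ κ→μ@(e , _ , closed) μ≤κ =
      mk↔ₛ′ e (proj₁ ∘ onto) (proj₂ ∘ onto) (λ x → e-inj (proj₂ (onto (e x))))
      where
      module μ = WellOrder (wellOrderOf μ)

      e-inj : Injective _≡_ _≡_ e
      e-inj = Injection.injective (initialEmbedding⇒≤ κ μ κ→μ)

      onto : ∀ y → ∃[ x ] e x ≡ y
      onto y = ¬¬-elim λ missed → Cardinal.initial μ y (e ∘ Injection.to μ≤κ)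
        (Injection.injective μ≤κ ∘ e-inj)
        λ x → case μ.compare (e (Injection.to μ≤κ x)) y of λ where
          (tri< lt _ _) → lt
          (tri≈ _ eq _) → contradiction (_ , eq) missed
          (tri> _ _ gt) → contradiction (closed _ y gt) missed

    regular-unbounded⇒≈ :
      ∀ κ μ → InfiniteRegular κ → InfiniteRegular μ →
      (g : Cardinal.Carrier μ → Cardinal.Carrier κ) → Unbounded κ g →
      (h : Cardinal.Carrier κ → Cardinal.Carrier μ) → Unbounded μ h → κ ≈ᶜ μ
    regular-unbounded⇒≈ κ μ κ-reg μ-reg g g-unb h h-unb = initialEmbedding-≥⇒≈ κ μ
      (regular-unbounded⇒initialEmbedding κ μ κ-reg g g-unb)
      (initialEmbedding⇒≤ μ κ (regular-unbounded⇒initialEmbedding μ κ μ-reg h h-unb))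

    module _ (κ : Cardinal ℓ) (κ-reg : InfiniteRegular κ) where
      private
        module κ = WellOrder (wellOrderOf κ)

      -- Regularity bounds the constant function x on a segment. Two distinct elements of κ provide
      -- a segment that is not empty, so the bound really exceeds x.
      regular⇒no-maximum : ∀ x → ∃[ y ] x κ.< y
      regular⇒no-maximum x with κ.compare i₀ i₁
        where
        i₀ = Injection.to (proj₁ κ-reg) 0
        i₁ = Injection.to (proj₁ κ-reg) 1
      ... | tri< lt _ _ = let c , below = proj₂ κ-reg _ (λ _ → x) in c , below _ lt
      ... | tri> _ _ gt = let c , below = proj₂ κ-reg _ (λ _ → x) in c , below _ gt
      ... | tri≈ _ eq _ = case Injection.injective (proj₁ κ-reg) eq of λ ()

      -- `P` is enumerated increasingly: by regularity the values taken before x are bounded, and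
      -- `P` has an element at or above that bound.
      unbounded⇒injection : (P : κ.Carrier → Set ℓ) → (∀ c → ∃[ x ] ¬ (x κ.< c) × P x) →
                            Σ[ e ∈ (κ.Carrier → κ.Carrier) ]
                              Injective _≡_ _≡_ e × (∀ x → P (e x))
      unbounded⇒injection P unb =
        e , κ.increasing⇒injective κ._<_ κ.<-irrefl {f = e} (λ {x} {y} → proj₁ (spec y) x) ,
        λ x → proj₂ (spec x)
        where
        rec = κ.recursion (element κ (proj₁ κ-reg)) λ x prev y →
          (∀ x′ (x′<x : x′ κ.< x) → prev x′ x′<x κ.< y) × P y
        e = proj₁ rec

        spec : ∀ x → (∀ x′ → x′ κ.< x → e x′ κ.< e x) × P (e x)
        spec x = proj₂ rec x
          (let c , below = proj₂ κ-reg x e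
               y , y≮c , Py = unb c
           in y , (λ x′ x′<x → κ.<-≮-trans (below x′ x′<x) y≮c) , Py)

      -- Either the points sent to the left are unbounded in κ, or from some `c₀` on every point is
      -- sent to the right. The unbounded side contains a copy of κ.
      regular-≤-⊎ : {A B : Set ℓ} → κ.Carrier ↣ (A ⊎ B) → (κ.Carrier ↣ A) ⊎ (κ.Carrier ↣ B)
      regular-≤-⊎ {A} {B} f with em {P = ∀ c → ∃[ x ] ¬ (x κ.< c) × ∃[ y ] f.to x ≡ inj₁ y}
        where module f = Injection f
      ... | yes unb =
        let e , e-inj , left = unbounded⇒injection _ unb
        in inj₁ (mk↣ {to = proj₁ ∘ left} λ {x} {x′} eq →
             e-inj (f.injective (trans (proj₂ (left x))
               (trans (cong inj₁ eq) (sym (proj₂ (left x′)))))))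
        where module f = Injection f
      ... | no ¬unb =
        let e , e-inj , right = unbounded⇒injection (λ x → ∃[ y ] f.to x ≡ inj₂ y) unb′
        in inj₂ (mk↣ {to = proj₁ ∘ right} λ {x} {x′} eq →
             e-inj (f.injective (trans (proj₂ (right x))
               (trans (cong inj₂ eq) (sym (proj₂ (right x′)))))))
        where
        module f = Injection f
        bound = ¬∀⇒∃¬ ¬unb
        c₀ = proj₁ bound

        right-of : ∀ x → ¬ (x κ.< c₀) → ∃[ y ] f.to x ≡ inj₂ y
        right-of x x≮c₀ with f.to x in eq
        ... | inj₁ y = contradiction (x , x≮c₀ , y , eq) (proj₂ bound)
        ... | inj₂ y = y , refl

        unb′ : ∀ c → ∃[ x ] ¬ (x κ.< c) × ∃[ y ] f.to x ≡ inj₂ y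
        unb′ c with em {P = c κ.< c₀}
        ... | yes c<c₀ = c₀ , (λ c₀<c → κ.<-irrefl (κ.<-trans c<c₀ c₀<c)) , right-of c₀ κ.<-irrefl
        ... | no  c≮c₀ = c , κ.<-irrefl , right-of c c≮c₀

  -- Cofinality

  module Cofinality {ℓ : Level} (P : Poset ℓ ℓ ℓ) (t₀ : Poset.Carrier P) where
    open Poset P using (_≈_; _≤_; antisym; reflexive; module Eq)
      renaming (Carrier to T; refl to ≤-refl; trans to ≤-trans)
    open ToStrict _≈_ _≤_ using () renaming (_<_ to _<ᵀ_)

    ≰-total⇒<ᵀ : ∀ {x y} → x ≤ y ⊎ y ≤ x → ¬ (y ≤ x) → x <ᵀ y
    ≰-total⇒<ᵀ (inj₁ x≤y) y≰x = x≤y , λ x≈y → y≰x (reflexive (Eq.sym x≈y))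
    ≰-total⇒<ᵀ (inj₂ y≤x) y≰x = contradiction y≤x y≰x

    <ᵀ⇒≱ : ∀ {x y} → x <ᵀ y → ¬ (y ≤ x)
    <ᵀ⇒≱ (x≤y , x≉y) y≤x = x≉y (antisym x≤y y≤x)

    <ᵀ-≤-trans : ∀ {x y z} → x <ᵀ y → y ≤ z → x <ᵀ z
    <ᵀ-≤-trans x<y@(x≤y , _) y≤z =
      ≤-trans x≤y y≤z , λ x≈z → <ᵀ⇒≱ x<y (≤-trans y≤z (reflexive (Eq.sym x≈z)))

    UnboundedChain : {I : Set ℓ} → (I → T) → Set ℓ
    UnboundedChain g = (∀ i j → g i ≤ g j ⊎ g j ≤ g i) × ¬ (∃[ u ] (∀ i → g i ≤ u))

    increasing⇒chain : ∀ W {g : WellOrder.Carrier {ℓ} W → T} → WellOrder.Increasing W _<ᵀ_ g →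
                       ∀ x y → g x ≤ g y ⊎ g y ≤ g x
    increasing⇒chain W inc x y = WellOrder.monotone⇒comparable W _≤_ ≤-refl {λ _ → ⊤}
      (λ _ x<y → proj₁ (inc x<y)) tt tt

    module _ (W : WellOrder ℓ) where
      open WellOrder W

      -- The values are only required to be comparable, not to increase, so the chain survives
      -- reindexing by arbitrary maps. A strictly increasing sequence is extracted once the index is
      -- as short as possible.
      Indexes : (Carrier → Set ℓ) → Set ℓ
      Indexes D = Σ[ g ∈ (Carrier → T) ]
        (∀ x y → g x ≤ g y ⊎ g y ≤ g x) × ¬ (∃[ u ] (∀ x → D x → g x ≤ u))

      -- Witnessed by {y | y < a} for the least possible a, or by all of W if
      -- there is no such a.
      IsLeastIndex : (Carrier → Bool) → Set ℓ
      IsLeastIndex D =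
        Indexes (λ x → Lift ℓ (D x ≡ true)) × (∀ x → D x ≡ true → ¬ Indexes (_< x))

      leastIndex : {g : Carrier → T} → UnboundedChain g → ∃ IsLeastIndex
      leastIndex {g} (chain , unb) with em {P = ∃[ a ] Indexes (_< a)}
      ... | no none = (λ _ → true) ,
        (g , chain , λ (u , g≤u) → unb (u , λ x → g≤u x (lift refl))) ,
        λ x _ i → none (x , i)
      ... | yes some =
        let a , (g , chain , unb) , least = minimal _ some
        in ⟦ _< a ⟧ ,
           (g , chain , λ (u , g≤u) → unb (u , λ x x<a → g≤u x (lift (∋-intro x<a)))) ,
           λ x x∈ → least x (∋-elim x∈)

      -- The least index of an unbounded chain is a regular cardinal and equals tree-tops.

      module LeastIndex (D : Carrier → Bool)
                        (g : Carrier → T) (g-chain : ∀ x y → g x ≤ g y ⊎ g y ≤ g x)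
                        (g-unbounded : ¬ (∃[ u ] (∀ x → Lift ℓ (D x ≡ true) → g x ≤ u)))
                        (least : ∀ x → D x ≡ true → ¬ Indexes (_< x)) where

        Θ : Set ℓ
        Θ = Σ[ x ∈ Carrier ] D x ≡ true

        Θ-≡ : ∀ {x y : Θ} → proj₁ x ≡ proj₁ y → x ≡ y
        Θ-≡ {x , x∈} {.x , x∈′} refl = cong (x ,_) (Decidable⇒UIP.≡-irrelevant _≟_ x∈ x∈′)

        _<ᶿ_ : Rel Θ ℓ
        _<ᶿ_ = _<_ on proj₁

        <ᶿ-compare : Trichotomous _≡_ _<ᶿ_
        <ᶿ-compare x y with compare (proj₁ x) (proj₁ y)
        ... | tri< lt ≢ ≯ = tri< lt (≢ ∘ cong proj₁) ≯
        ... | tri≈ ≮ eq ≯ = tri≈ ≮ (Θ-≡ eq) ≯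
        ... | tri> ≮ ≢ gt = tri> ≮ (≢ ∘ cong proj₁) gt

        segment : WellOrder ℓ
        segment = record
          { Carrier            = Θ
          ; _<_                = _<ᶿ_
          ; isStrictTotalOrder = record
            { isStrictPartialOrder = record
              { isEquivalence = isEquivalence
              ; irrefl        = λ { refl → <-irrefl }
              ; trans         = <-trans
              ; <-resp-≈      = resp₂ _<ᶿ_
              }
            ; compare = <ᶿ-compare
            }
          ; wellFounded = On.wellFounded proj₁ wellFounded
          }

        h : Θ → T
        h = g ∘ proj₁

        h-chain : ∀ x y → h x ≤ h y ⊎ h y ≤ h x
        h-chain x y = g-chain (proj₁ x) (proj₁ y)

        h-unbounded : ¬ (∃[ u ] (∀ x → h x ≤ u))
        h-unbounded (u , h≤u) = g-unbounded (u , λ x x∈ → h≤u (x , lower x∈))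

        extend : {A : Set ℓ} → A → (Θ → A) → Carrier → A
        extend d f x with em {P = D x ≡ true}
        ... | yes x∈ = f (x , x∈)
        ... | no  _  = d

        extend-≡ : {A : Set ℓ} (d : A) (f : Θ → A) → ∀ x → extend d f (proj₁ x) ≡ f x
        extend-≡ d f x with em {P = D (proj₁ x) ≡ true}
        ... | yes _  = cong f (Θ-≡ refl)
        ... | no  x∉ = contradiction (proj₂ x) x∉

        -- Extended by the constant `f a` outside Θ, an f unbounded below a would be an unbounded
        -- chain indexed by a shorter segment, against the choice of `D`.
        proper-segment-bounded : ∀ a (f : Θ → T) → (∀ x y → f x ≤ f y ⊎ f y ≤ f x) →
                                 ∃[ u ] (∀ x → x <ᶿ a → f x ≤ u)
        proper-segment-bounded a f chain = ¬¬-elim λ unb →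
          least (proj₁ a) (proj₂ a)
            ( extend (f a) f
            , (λ x y → extended-chain x y)
            , λ (u , f≤u) → unb (u , λ x x<a → subst (_≤ u) (extend-≡ (f a) f x) (f≤u _ x<a)))
          where
          value : ∀ x → ∃[ i ] extend (f a) f x ≡ f i
          value x with em {P = D x ≡ true}
          ... | yes x∈ = (x , x∈) , refl
          ... | no  _  = a , refl

          extended-chain : ∀ x y → extend (f a) f x ≤ extend (f a) f y ⊎
                                   extend (f a) f y ≤ extend (f a) f x
          extended-chain x y with value x | value y
          ... | i , eq | j , eq′ rewrite eq | eq′ = chain i j

        -- The reindexed chain is bounded on the segment, while h as a whole is not; a value of h
        -- that escapes the bound is comparable with the others and hence strictly above them.
        proper-segment-strictly-bounded : ∀ a (k : Θ → Θ) → ∃[ z ] (∀ x → x <ᶿ a → h (k x) <ᵀ h z)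
        proper-segment-strictly-bounded a k =
          let u , hk≤u = proper-segment-bounded a (h ∘ k) (λ x y → h-chain (k x) (k y))
              z , hz≰u = ¬∀⇒∃¬ λ h≤u → h-unbounded (u , h≤u)
          in z , λ x x<a → ≰-total⇒<ᵀ (h-chain (k x) z) λ hz≤ → hz≰u (≤-trans hz≤ (hk≤u x x<a))

        θ : Cardinal ℓ
        θ = record
          -- A left inverse of `f`, with default `a` off its range, reindexes h so that every value
          -- occurs below `a`. A strict bound `h z` of these values would then exceed itself.
          { WellOrder segment
          ; initial = λ a f f-inj f<a →
              let inverse : Θ → Θ
                  inverse = λ y → [ proj₁ , (λ _ → a) ]′ (toSum (em {P = ∃[ x ] f x ≡ y}))
                  z , below = proper-segment-strictly-bounded a inverse
              in <ᵀ⇒≱ (subst (λ x → h x <ᵀ h z) (inverse-f f-inj a z) (below (f z) (f<a z))) ≤-refl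
          }
          where
          inverse-f : ∀ {f : Θ → Θ} → Injective _≡_ _≡_ f → ∀ a x →
                      [ proj₁ , (λ _ → a) ]′ (toSum (em {P = ∃[ x′ ] f x′ ≡ f x})) ≡ x
          inverse-f {f} f-inj a x with em {P = ∃[ x′ ] f x′ ≡ f x}
          ... | yes (x′ , eq) = f-inj eq
          ... | no  none      = contradiction (x , refl) none

        private
          module θ = WellOrder segment

          start : Θ
          start = proj₁ (¬∀⇒∃¬ λ h≤t₀ → h-unbounded (t₀ , h≤t₀))

          -- Reindexes h so that it increases strictly and stays above the original h, which keeps
          -- it unbounded: the next value is the larger of `h a` and a strict bound of the earlier
          -- values.
          index : Σ[ F ∈ (Θ → Θ) ] (∀ a →
                  (∀ x → x <ᶿ a → h (F x) <ᵀ h (F a)) × h a ≤ h (F a))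
          index = proj₁ rec , λ a → proj₂ rec a
            (let z , below = proper-segment-strictly-bounded a (proj₁ rec)
             in case h-chain a z of λ where
               (inj₁ ha≤hz) → z , below , ha≤hz
               (inj₂ hz≤ha) → a , (λ x x<a → <ᵀ-≤-trans (below x x<a) hz≤ha) , ≤-refl)
            where
            rec = θ.recursion start λ a prev z →
              (∀ x (x<a : x <ᶿ a) → h (prev x x<a) <ᵀ h z) × h a ≤ h z

        sequence : Θ → T
        sequence = h ∘ proj₁ index

        sequence-increasing : θ.Increasing _<ᵀ_ sequence
        sequence-increasing {x} {y} = proj₁ (proj₂ index y) x

        sequence-unbounded : ¬ (∃[ u ] (∀ x → sequence x ≤ u))
        sequence-unbounded (u , s≤u) =
          h-unbounded (u , λ x → ≤-trans (proj₂ (proj₂ index x)) (s≤u x))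

        sequence-cancel-< : ∀ x y → sequence x <ᵀ sequence y → x <ᶿ y
        sequence-cancel-< x y sx<sy with θ.compare x y
        ... | tri< x<y _ _  = x<y
        ... | tri≈ _ refl _ = contradiction ≤-refl (<ᵀ⇒≱ sx<sy)
        ... | tri> _ _ y<x  = contradiction (proj₁ (sequence-increasing y<x)) (<ᵀ⇒≱ sx<sy)

        hasUnboundedSequence : HasUnboundedSequence P θ
        hasUnboundedSequence = sequence , sequence-increasing , sequence-unbounded

        -- The sequence reindexed by f stays strictly below some `h z`, which is at most
        -- `sequence z`; cancelling the increasing sequence bounds f by z.
        θ-regular : Regular θ
        θ-regular a f =
          let z , below = proper-segment-strictly-bounded a (proj₁ index ∘ f)
          in z , λ b b<a → sequence-cancel-< (f b) z (<ᵀ-≤-trans (below b b<a) (proj₂ (proj₂ index z)))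

        θ-infinite : Infinite θ
        θ-infinite = mk↣ {to = iterate} λ {m} {n} eq → case ℕₚ.<-cmp m n of λ where
            (tri< m<n _ _) → contradiction (subst (_<ᶿ iterate n) eq (iterate-mono m<n)) <-irrefl
            (tri≈ _ m≡n _) → m≡n
            (tri> _ _ n<m) → contradiction (subst (iterate n <ᶿ_) eq (iterate-mono n<m)) <-irrefl
          where
          larger : ∀ x → ∃[ y ] x <ᶿ y
          larger x =
            let y , sy≰sx = ¬∀⇒∃¬ λ s≤sx → sequence-unbounded (sequence x , s≤sx)
            in y , sequence-cancel-< x y
                     (≰-total⇒<ᵀ (increasing⇒chain segment {sequence}
                       (λ {i} {j} → sequence-increasing {i} {j}) x y) sy≰sx)

          iterate : ℕ → Θ
          iterate ℕ.zero    = start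
          iterate (ℕ.suc n) = proj₁ (larger (iterate n))

          iterate-mono : ∀ {m n} → m ℕ.< n → iterate m <ᶿ iterate n
          iterate-mono m<n = go (ℕₚ.<⇒<′ m<n)
            where
            go : ∀ {m n} → m ℕ.<′ n → iterate m <ᶿ iterate n
            go ℕ.<′-base       = proj₂ (larger _)
            go (ℕ.<′-step m<n) = <-trans (go m<n) (proj₂ (larger _))

        infiniteRegular : InfiniteRegular θ
        infiniteRegular = θ-infinite , θ-regular

        θ↣W : Θ ↣ Carrier
        θ↣W = mk↣ {to = proj₁} Θ-≡

        isTreeTops : IsTreeTops P θ
        isTreeTops = hasUnboundedSequence , minimum
          where
          -- If θ did not embed in ν, a proper segment of θ would cover ν, and the sequence
          -- transported to that segment would be bounded by leastness of the index.
          minimum : ∀ ν → HasUnboundedSequence P ν → θ ≤ᶜ ν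
          minimum ν (s , inc , unb)
            with comparison segment (wellOrderOf ν) (proj₁ (¬∀⇒∃¬ λ s≤t₀ → unb (t₀ , s≤t₀)))
          ... | inj₁ e = initialEmbedding⇒≤ θ ν e
          ... | inj₂ (a , e , cover) =
            let u , se≤u = proper-segment-bounded a (s ∘ e)
                             (λ x y → increasing⇒chain (wellOrderOf ν) inc (e x) (e y))
            in ⊥-elim (unb (u , λ y →
                 let x , x<a , eq = cover y in subst (λ z → s z ≤ u) eq (se≤u x x<a)))

    -- For a sequence tree and `W` = κ, the injection into `W` bounds tree-tops by κ. For the upper
    -- bounds of a sequence in reverse order, θ is their coinitiality.
    treeTops : (W : WellOrder ℓ) {g : WellOrder.Carrier W → T} → UnboundedChain g →
               ∃[ θ ] InfiniteRegular θ × (Cardinal.Carrier θ ↣ WellOrder.Carrier W) ×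
                      IsTreeTops P θ
    treeTops W unb =
      let D , (g , g-chain , g-unb) , least = leastIndex W unb
          open LeastIndex W D g g-chain g-unb least
      in θ , infiniteRegular , θ↣W , isTreeTops

module Model (em : EM) (fe : FunExt) {ℓ : Level} (V̂ : ModelZFC⁻ ℓ) where
  open Classical em fe
  open ModelZFC⁻ V̂
  open Equivalence using (to; from)

  -- Definability

  -- Carries a formula along with the predicate it defines, so that the axiom schemes of the model
  -- can be applied to predicates written directly in the metatheory.
  record Definable {n} (P : Vec M n → Set ℓ) : Set ℓ where
    constructor definable
    field
      formula : Formula n
      correct : ∀ ρ → Sat formula ρ ⇔ P ρ

  open Definable

  module _ {n : ℕ} where

    infix  8 _∈ᵈ_ _≡ᵈ_
    infix  7 ¬ᵈ_ ∀ᵈ_ ∃ᵈ_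
    infixr 6 _×ᵈ_
    infixr 5 _⊎ᵈ_
    infixr 4 _→ᵈ_ _⇔ᵈ_

    _∈ᵈ_ : (i j : Fin n) → Definable (λ ρ → lookup ρ i ∈ lookup ρ j)
    i ∈ᵈ j = definable (i ∈̇ j) λ ρ → mk⇔ id id

    _≡ᵈ_ : (i j : Fin n) → Definable (λ ρ → lookup ρ i ≡ lookup ρ j)
    i ≡ᵈ j = definable (i ≐ j) λ ρ → mk⇔ id id

    ¬ᵈ_ : {P : Vec M n → Set ℓ} → Definable P → Definable (λ ρ → ¬ P ρ)
    ¬ᵈ p = definable (¬̇ formula p) λ ρ →
      mk⇔ (_∘ from (correct p ρ)) (_∘ to (correct p ρ))

    _×ᵈ_ : {P Q : Vec M n → Set ℓ} → Definable P → Definable Q → Definable (λ ρ → P ρ × Q ρ)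
    p ×ᵈ q = definable (formula p ∧̇ formula q) λ ρ → mk⇔
      (λ (x , y) → to (correct p ρ) x , to (correct q ρ) y)
      (λ (x , y) → from (correct p ρ) x , from (correct q ρ) y)

    _⊎ᵈ_ : {P Q : Vec M n → Set ℓ} → Definable P → Definable Q → Definable (λ ρ → P ρ ⊎ Q ρ)
    p ⊎ᵈ q = definable (formula p ∨̇ formula q) λ ρ → mk⇔
      (Sum.map (to (correct p ρ)) (to (correct q ρ)))
      (Sum.map (from (correct p ρ)) (from (correct q ρ)))

    _→ᵈ_ : {P Q : Vec M n → Set ℓ} → Definable P → Definable Q → Definable (λ ρ → P ρ → Q ρ)
    p →ᵈ q = definable (formula p ⇒̇ formula q) λ ρ → mk⇔
      (λ f → to (correct q ρ) ∘ f ∘ from (correct p ρ))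
      (λ f → from (correct q ρ) ∘ f ∘ to (correct p ρ))

    ∀ᵈ_ : {P : Vec M (ℕ.suc n) → Set ℓ} → Definable P → Definable (λ ρ → ∀ x → P (x ∷ ρ))
    ∀ᵈ p = definable (∀̇ formula p) λ ρ → mk⇔
      (λ f x → to (correct p (x ∷ ρ)) (f x))
      (λ f x → from (correct p (x ∷ ρ)) (f x))

    ∃ᵈ_ : {P : Vec M (ℕ.suc n) → Set ℓ} → Definable P → Definable (λ ρ → ∃[ x ] P (x ∷ ρ))
    ∃ᵈ p = definable (∃̇ formula p) λ ρ → mk⇔
      (λ (x , Px) → x , to (correct p (x ∷ ρ)) Px)
      (λ (x , Px) → x , from (correct p (x ∷ ρ)) Px)

    _⇔ᵈ_ : {P Q : Vec M n → Set ℓ} → Definable P → Definable Q → Definable (λ ρ → P ρ ⇔ Q ρ)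
    p ⇔ᵈ q = definable (formula pq ∧̇ formula qp) λ ρ → mk⇔
      (λ (f , g) → mk⇔ (to (correct pq ρ) f) (to (correct qp ρ) g))
      (λ e → from (correct pq ρ) (to e) , from (correct qp ρ) (from e))
      where
      pq = p →ᵈ q
      qp = q →ᵈ p

  isEmptyᵈ : ∀ {n} i → Definable {n} (λ ρ → IsEmpty (lookup ρ i))
  isEmptyᵈ i = ∀ᵈ (¬ᵈ (0F ∈ᵈ suc i))

  isSucᵈ : ∀ {n} i j → Definable {n} (λ ρ → IsSuc (lookup ρ i) (lookup ρ j))
  isSucᵈ i j = ∀ᵈ (0F ∈ᵈ suc j ⇔ᵈ 0F ∈ᵈ suc i ⊎ᵈ 0F ≡ᵈ suc i)

  isPairᵈ : ∀ {n} i j k → Definable {n} (λ ρ → IsPair (lookup ρ i) (lookup ρ j) (lookup ρ k))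
  isPairᵈ i j k = ∀ᵈ (0F ∈ᵈ suc i ⇔ᵈ 0F ≡ᵈ suc j ⊎ᵈ 0F ≡ᵈ suc k)

  inductiveᵈ : ∀ {n} i → Definable {n} (λ ρ → Inductive (lookup ρ i))
  inductiveᵈ i =
    (∃ᵈ (isEmptyᵈ 0F ×ᵈ 0F ∈ᵈ suc i)) ×ᵈ
    ∀ᵈ (0F ∈ᵈ suc i →ᵈ ∃ᵈ (isSucᵈ 1F 0F ×ᵈ 0F ∈ᵈ suc (suc i)))

  isNatᵈ : ∀ {n} i → Definable {n} (λ ρ → IsNat (lookup ρ i))
  isNatᵈ i = ∀ᵈ (inductiveᵈ 0F →ᵈ suc i ∈ᵈ 0F)

  isOrderedPairᵈ : ∀ {n} i j k →
    Definable {n} (λ ρ → IsOrderedPair (lookup ρ i) (lookup ρ j) (lookup ρ k))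
  isOrderedPairᵈ i j k =
    ∃ᵈ (∃ᵈ (isPairᵈ 1F (suc (suc j)) (suc (suc j)) ×ᵈ
            isPairᵈ 0F (suc (suc j)) (suc (suc k)) ×ᵈ
            isPairᵈ (suc (suc i)) 1F 0F))

  relatedᵈ : ∀ {n} i j k → Definable {n} (λ ρ → Related (lookup ρ i) (lookup ρ j) (lookup ρ k))
  relatedᵈ i j k = ∃ᵈ (isOrderedPairᵈ 0F (suc j) (suc k) ×ᵈ 0F ∈ᵈ suc i)

  isFunctionᵈ : ∀ {n} i j k →
    Definable {n} (λ ρ → IsFunction (lookup ρ i) (lookup ρ j) (lookup ρ k))
  isFunctionᵈ i j k =
    ∀ᵈ (0F ∈ᵈ suc i →ᵈ ∃ᵈ (∃ᵈ (1F ∈ᵈ suc (suc (suc j)) ×ᵈ 0F ∈ᵈ suc (suc (suc k)) ×ᵈ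
                               isOrderedPairᵈ 2F 1F 0F))) ×ᵈ
    ∀ᵈ (0F ∈ᵈ suc j →ᵈ ∃ᵈ (relatedᵈ (suc (suc i)) 1F 0F ×ᵈ
                           ∀ᵈ (relatedᵈ (suc (suc (suc i))) 2F 0F →ᵈ 0F ≡ᵈ 1F)))

  module _ {n : ℕ} {P : Vec M (ℕ.suc n) → Set ℓ} (p : Definable P) (ρ : Vec M n) where

    separate : ∀ a → ∃[ b ] (∀ z → z ∈ b ⇔ (z ∈ a × P (z ∷ ρ)))
    separate a =
      let b , b-spec = separation (formula p) ρ a
      in b , λ z → mk⇔
        (λ z∈b → let z∈a , φ = to (b-spec z) z∈b in z∈a , to (correct p (z ∷ ρ)) φ)
        (λ (z∈a , Pz) → from (b-spec z) (z∈a , from (correct p (z ∷ ρ)) Pz))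

    -- Foundation for the subset cut out by separation. On elements of ω̂ this is the least number
    -- principle, which covers nonstandard numbers because the predicate is definable.
    least-∈ : ∀ a → ∃[ x ] x ∈ a × P (x ∷ ρ) →
              ∃[ x ] x ∈ a × P (x ∷ ρ) × (∀ y → y ∈ a → y ∈ x → ¬ P (y ∷ ρ))
    least-∈ a (x , x∈a , Px) =
      let b , b-spec = separate a
          m , m∈b , m-min = foundation b λ empty → empty x (from (b-spec x) (x∈a , Px))
          m∈a , Pm = to (b-spec m) m∈b
      in m , m∈a , Pm , λ y y∈a y∈m Py → m-min y (from (b-spec y) (y∈a , Py)) y∈m

  collect : ∀ {n} {P : Vec M (ℕ.suc (ℕ.suc n)) → Set ℓ} → Definable P → ∀ ρ a →
            (∀ x → x ∈ a → ∃[ y ] P (y ∷ x ∷ ρ)) →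
            ∃[ b ] (∀ x → x ∈ a → ∃[ y ] y ∈ b × P (y ∷ x ∷ ρ))
  collect p ρ a total =
    let b , b-spec = collection (formula p) ρ a λ x x∈a →
          let y , Py = total x x∈a in y , from (correct p (y ∷ x ∷ ρ)) Py
    in b , λ x x∈a → let y , y∈b , φ = b-spec x x∈a in y , y∈b , to (correct p (y ∷ x ∷ ρ)) φ

  -- The order of ω̂

  ∈-asym : ∀ {x y} → x ∈ y → ¬ (y ∈ x)
  ∈-asym {x} {y} x∈y y∈x with pairing x y
  ... | u , u-spec with foundation u (λ empty → empty x (from (u-spec x) (inj₁ refl)))
  ...   | z , z∈u , z-min with to (u-spec z) z∈u
  ...     | inj₁ refl = z-min y (from (u-spec y) (inj₂ refl)) y∈x
  ...     | inj₂ refl = z-min x (from (u-spec x) (inj₁ refl)) x∈y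

  ∈-irrefl : ∀ {x} → ¬ (x ∈ x)
  ∈-irrefl x∈x = ∈-asym x∈x x∈x

  ∅ : M
  ∅ = proj₁ (proj₁ (proj₂ infinity))

  ∅-empty : IsEmpty ∅
  ∅-empty = proj₁ (proj₂ (proj₁ (proj₂ infinity)))

  IsEmpty⇒≡∅ : ∀ {x} → IsEmpty x → x ≡ ∅
  IsEmpty⇒≡∅ empty = extensionality _ _ λ z →
    mk⇔ (λ z∈ → contradiction z∈ (empty z)) (λ z∈ → contradiction z∈ (∅-empty z))

  successor : ∀ x → ∃ (IsSuc x)
  successor x =
    let s , s-spec = pairing x x
        u , u-spec = pairing x s
        y , y-spec = union u
    in y , λ z → mk⇔
      (λ z∈y → let w , w∈u , z∈w = to (y-spec z) z∈y in
        [ (λ w≡x → inj₁ (subst (z ∈_) w≡x z∈w))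
        , (λ w≡s → inj₂ ([ id , id ]′ (to (s-spec z) (subst (z ∈_) w≡s z∈w))))
        ]′ (to (u-spec w) w∈u))
      [ (λ z∈x → from (y-spec z) (x , from (u-spec x) (inj₁ refl) , z∈x))
      , (λ z≡x → from (y-spec z) (s , from (u-spec s) (inj₂ refl) , from (s-spec z) (inj₁ z≡x)))
      ]′

  σ : M → M
  σ x = proj₁ (successor x)

  σ-isSuc : ∀ {x} → IsSuc x (σ x)
  σ-isSuc = proj₂ (successor _)

  IsSuc⇒≡σ : ∀ {x y} → IsSuc x y → y ≡ σ x
  IsSuc⇒≡σ s = extensionality _ _ λ z →
    mk⇔ (from (σ-isSuc z) ∘ to (s z)) (from (s z) ∘ to (σ-isSuc z))

  ∈σ : ∀ {x} → x ∈ σ x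
  ∈σ = from (σ-isSuc _) (inj₂ refl)

  ∈⇒∈σ : ∀ {x y} → x ∈ y → x ∈ σ y
  ∈⇒∈σ x∈y = from (σ-isSuc _) (inj₁ x∈y)

  nat-∅ : IsNat ∅
  nat-∅ w ((e , e-empty , e∈w) , _) = subst (_∈ w) (IsEmpty⇒≡∅ e-empty) e∈w

  nat-σ : ∀ {x} → IsNat x → IsNat (σ x)
  nat-σ {x} nx w ind@(_ , closed) =
    let y , y-suc , y∈w = closed x (nx w ind) in subst (_∈ w) (IsSuc⇒≡σ y-suc) y∈w

  -- Separation turns the naturals with the property into a set inside some inductive set; this set
  -- is itself inductive and so contains every natural.
  ω-induction : ∀ {n} {P : Vec M (ℕ.suc n) → Set ℓ} → Definable P → ∀ ρ →
                P (∅ ∷ ρ) → (∀ {x} → IsNat x → P (x ∷ ρ) → P (σ x ∷ ρ)) →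
                ∀ {x} → IsNat x → P (x ∷ ρ)
  ω-induction p ρ base step {x} nx =
    let w , w-ind = infinity
        b , b-spec = separate (isNatᵈ 0F ×ᵈ p) ρ w
        x∈b = nx b
          ( (∅ , ∅-empty , from (b-spec ∅) (nat-∅ w w-ind , nat-∅ , base))
          , λ y y∈b → let _ , ny , Py = to (b-spec y) y∈b in
              σ y , σ-isSuc , from (b-spec (σ y)) (nat-σ ny w w-ind , nat-σ ny , step ny Py) )
    in proj₂ (proj₂ (to (b-spec x) x∈b))

  ∈-nat : ∀ {n x} → IsNat n → x ∈ n → IsNat x
  ∈-nat nn = ω-induction (∀ᵈ (0F ∈ᵈ 1F →ᵈ isNatᵈ 0F)) []
    (λ x x∈∅ → contradiction x∈∅ (∅-empty x))
    (λ nn IH x x∈σn → case to (σ-isSuc x) x∈σn of λ where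
      (inj₁ x∈n)  → IH x x∈n
      (inj₂ refl) → nn)
    nn _

  ∈-trans : ∀ {n x y} → IsNat n → x ∈ y → y ∈ n → x ∈ n
  ∈-trans nn x∈y y∈n = ω-induction
    (∀ᵈ (0F ∈ᵈ 1F →ᵈ ∀ᵈ (0F ∈ᵈ 1F →ᵈ 0F ∈ᵈ 2F))) []
    (λ y y∈∅ → contradiction y∈∅ (∅-empty y))
    (λ nn IH y y∈σn x x∈y → case to (σ-isSuc y) y∈σn of λ where
      (inj₁ y∈n)  → ∈⇒∈σ (IH y y∈n x x∈y)
      (inj₂ refl) → ∈⇒∈σ x∈y)
    nn _ y∈n _ x∈y

  ∅-minimum : ∀ {n} → IsNat n → n ≡ ∅ ⊎ ∅ ∈ n
  ∅-minimum = ω-induction (0F ≡ᵈ 1F ⊎ᵈ 1F ∈ᵈ 0F) (∅ ∷ [])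
    (inj₁ refl)
    (λ _ → inj₂ ∘ [ (λ { refl → ∈σ }) , ∈⇒∈σ ]′)

  σ-≤ : ∀ {m n} → IsNat n → m ∈ n → σ m ∈ n ⊎ σ m ≡ n
  σ-≤ {m} nn = ω-induction (1F ∈ᵈ 0F →ᵈ 2F ∈ᵈ 0F ⊎ᵈ 2F ≡ᵈ 0F) (m ∷ σ m ∷ [])
    (λ m∈∅ → contradiction m∈∅ (∅-empty m))
    (λ _ IH m∈σn → case to (σ-isSuc m) m∈σn of λ where
      (inj₁ m∈n)  → inj₁ ([ ∈⇒∈σ , (λ eq → subst (_∈ σ _) (sym eq) ∈σ) ]′ (IH m∈n))
      (inj₂ refl) → inj₂ refl)
    nn

  data Trichotomy (m n : M) : Set ℓ where
    less    : m ∈ n → Trichotomy m n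
    equal   : m ≡ n → Trichotomy m n
    greater : n ∈ m → Trichotomy m n

  trichotomy : ∀ {m n} → IsNat m → IsNat n → Trichotomy m n
  trichotomy {m} nm nn = [ less , [ equal , greater ]′ ]′
    (ω-induction (1F ∈ᵈ 0F ⊎ᵈ 1F ≡ᵈ 0F ⊎ᵈ 0F ∈ᵈ 1F) (m ∷ [])
      ([ inj₂ ∘ inj₁ , inj₂ ∘ inj₂ ]′ (∅-minimum nm))
      (λ _ → [ inj₁ ∘ ∈⇒∈σ
             , [ (λ { refl → inj₁ ∈σ })
               , (λ n∈m → [ inj₂ ∘ inj₂ , inj₂ ∘ inj₁ ∘ sym ]′ (σ-≤ nm n∈m)) ]′ ]′)
      nn)

  -- On ω̂, x ∉ y is the weak order y ≤ x.

  ∈-∉-trans : ∀ {x y z} → IsNat y → IsNat z → x ∈ y → ¬ (z ∈ y) → x ∈ z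
  ∈-∉-trans ny nz x∈y z∉y with trichotomy ny nz
  ... | less y∈z   = ∈-trans nz x∈y y∈z
  ... | equal refl = x∈y
  ... | greater z∈y = contradiction z∈y z∉y

  ∉-∈-trans : ∀ {x y z} → IsNat x → IsNat y → IsNat z → ¬ (y ∈ x) → y ∈ z → x ∈ z
  ∉-∈-trans nx ny nz y∉x y∈z with trichotomy nx ny
  ... | less x∈y    = ∈-trans nz x∈y y∈z
  ... | equal refl  = y∈z
  ... | greater y∈x = contradiction y∈x y∉x

  ∈σ⇒∌ : ∀ {x y} → x ∈ σ y → ¬ (y ∈ x)
  ∈σ⇒∌ {x} x∈σy y∈x with to (σ-isSuc x) x∈σy
  ... | inj₁ x∈y  = ∈-asym x∈y y∈x
  ... | inj₂ refl = ∈-irrefl y∈x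

  ∌⇒∈σ : ∀ {x y} → IsNat x → IsNat y → ¬ (y ∈ x) → x ∈ σ y
  ∌⇒∈σ nx ny y∉x = ∉-∈-trans nx ny (nat-σ ny) y∉x ∈σ

  σ-mono : ∀ {m n} → IsNat n → m ∈ n → σ m ∈ σ n
  σ-mono {n = n} nn m∈n = [ ∈⇒∈σ , (λ σm≡n → subst (_∈ σ n) (sym σm≡n) ∈σ) ]′ (σ-≤ nn m∈n)

  predecessor : ∀ {n m} → IsNat n → m ∈ n → ∃[ p ] IsNat p × n ≡ σ p
  predecessor {n} {m} nn m∈n =
    [ (λ { refl → contradiction m∈n (∅-empty m) })
    , (λ (p , np , p-suc) → p , np , IsSuc⇒≡σ p-suc)
    ]′ (ω-induction (0F ≡ᵈ 1F ⊎ᵈ ∃ᵈ (isNatᵈ 0F ×ᵈ isSucᵈ 0F 1F)) (∅ ∷ [])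
          (inj₁ refl) (λ nx _ → inj₂ (_ , nx , σ-isSuc)) nn)

  ∈⇒⊆ : ∀ {x y} → IsNat y → x ∈ y → x ⊆ y
  ∈⇒⊆ ny x∈y z z∈x = ∈-trans ny z∈x x∈y

  ⊆⇒∌ : ∀ {x y} → x ⊆ y → ¬ (y ∈ x)
  ⊆⇒∌ x⊆y y∈x = ∈-irrefl (x⊆y _ y∈x)

  -- Ordered pairs and functions

  orderedPair : ∀ x y → ∃[ p ] IsOrderedPair p x y
  orderedPair x y =
    let u , u-pair = pairing x x
        v , v-pair = pairing x y
        p , p-pair = pairing u v
    in p , u , v , u-pair , v-pair , p-pair

  pair-unique : ∀ {u v x y} → IsPair u x y → IsPair v x y → u ≡ v
  pair-unique u-pair v-pair = extensionality _ _ λ z →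
    mk⇔ (from (v-pair z) ∘ to (u-pair z)) (from (u-pair z) ∘ to (v-pair z))

  orderedPair-unique : ∀ {p q x y} → IsOrderedPair p x y → IsOrderedPair q x y → p ≡ q
  orderedPair-unique (u , v , u-pair , v-pair , p-pair) (u′ , v′ , u′-pair , v′-pair , q-pair)
    with pair-unique u-pair u′-pair | pair-unique v-pair v′-pair
  ... | refl | refl = pair-unique p-pair q-pair

  singleton-∈ : ∀ {u x z} → IsPair u x x → z ∈ u → z ≡ x
  singleton-∈ u-pair z∈u = [ id , id ]′ (to (u-pair _) z∈u)

  fst∈ : ∀ {u x y} → IsPair u x y → x ∈ u
  fst∈ u-pair = from (u-pair _) (inj₁ refl)

  snd∈ : ∀ {u x y} → IsPair u x y → y ∈ u
  snd∈ u-pair = from (u-pair _) (inj₂ refl)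

  orderedPair-injective : ∀ {p x y x′ y′} → IsOrderedPair p x y → IsOrderedPair p x′ y′ →
                          x ≡ x′ × y ≡ y′
  orderedPair-injective {x = x} {y} {x′} {y′} (u , v , u-pair , v-pair , p-pair)
                        (u′ , v′ , u′-pair , v′-pair , p-pair′) = sym x′≡x , y≡y′
    where
    x′≡x : x′ ≡ x
    x′≡x with to (p-pair′ u) (fst∈ p-pair)
    ... | inj₁ refl = singleton-∈ u-pair (fst∈ u′-pair)
    ... | inj₂ refl = singleton-∈ u-pair (fst∈ v′-pair)

    y≡y′ : y ≡ y′
    y≡y′ with to (p-pair′ v) (snd∈ p-pair)
    ... | inj₂ refl with to (v′-pair y) (snd∈ v-pair) | to (v-pair y′) (snd∈ v′-pair)
    ...   | inj₂ eq | _        = eq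
    ...   | inj₁ _  | inj₂ eq  = sym eq
    ...   | inj₁ eq | inj₁ eq′ = trans eq (trans x′≡x (sym eq′))
    y≡y′ | inj₁ refl with singleton-∈ u′-pair (snd∈ v-pair) | to (p-pair v′) (snd∈ p-pair′)
    ...   | y≡x′ | inj₁ refl = trans y≡x′ (trans x′≡x (sym (singleton-∈ u-pair (snd∈ v′-pair))))
    ...   | y≡x′ | inj₂ refl = trans y≡x′ (sym (singleton-∈ u′-pair (snd∈ v′-pair)))

  related⇒∈ : ∀ {r p x y} → Related r x y → IsOrderedPair p x y → p ∈ r
  related⇒∈ {r} (q , q-pair , q∈r) p-pair = subst (_∈ r) (orderedPair-unique q-pair p-pair) q∈r

  module _ {f a b : M} (f-fun : IsFunction f a b) where

    function-∈ : ∀ {x y} → Related f x y → x ∈ a × y ∈ b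
    function-∈ (p , p-pair , p∈f) with proj₁ f-fun p p∈f
    ... | x , y , x∈a , y∈b , p-pair′ with orderedPair-injective p-pair p-pair′
    ...   | refl , refl = x∈a , y∈b

    function-value : ∀ {x} → x ∈ a → ∃ (Related f x)
    function-value x∈a = let y , r , _ = proj₂ f-fun _ x∈a in y , r

    function-unique : ∀ {x y y′} → Related f x y → Related f x y′ → y ≡ y′
    function-unique r r′ =
      let _ , _ , unique = proj₂ f-fun _ (proj₁ (function-∈ r))
      in trans (unique _ r) (sym (unique _ r′))

    function-⊆ : ∀ {g} → (∀ {x y} → Related f x y → Related g x y) → f ⊆ g
    function-⊆ f⇒g p p∈f =
      let x , y , _ , _ , p-pair = proj₁ f-fun p p∈f
      in related⇒∈ (f⇒g (p , p-pair , p∈f)) p-pair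

  ⊆⇒related : ∀ {f g x y} → f ⊆ g → Related f x y → Related g x y
  ⊆⇒related f⊆g (p , p-pair , p∈f) = p , p-pair , f⊆g p p∈f

  -- R may mention three parameters; its formula is given for
  -- every choice of variables because it is used under different quantifiers.
  module _ (R : M → M → M → M → M → Set ℓ)
           (Rᵈ : ∀ {n} (x y i j k : Fin n) →
                 Definable (λ ρ → R (lookup ρ x) (lookup ρ y) (lookup ρ i) (lookup ρ j) (lookup ρ k)))
           (i j k a b : M)
           (total  : ∀ {x} → x ∈ a → ∃[ y ] y ∈ b × R x y i j k)
           (unique : ∀ {x y y′} → x ∈ a → R x y i j k → R x y′ i j k → y ≡ y′) where

    define-function :
      ∃[ f ] IsFunction f a b × (∀ {x y} → Related f x y ⇔ (x ∈ a × R x y i j k))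
    define-function = f , (f-pairs , f-total) , mk⇔ related⇒R (λ (x∈a , Rxy) → R⇒related x∈a Rxy)
      where
      -- Collection provides a set containing the pairs, from which separation cuts out the graph.
      c = collect (∃ᵈ (Rᵈ 2F 0F 3F 4F 5F ×ᵈ isOrderedPairᵈ 1F 2F 0F)) (i ∷ j ∷ k ∷ []) a
            λ x x∈a → let y , _ , Rxy = total x∈a ; p , p-pair = orderedPair x y
                      in p , y , Rxy , p-pair
      s = separate (∃ᵈ (∃ᵈ (1F ∈ᵈ 6F ×ᵈ 0F ∈ᵈ 7F ×ᵈ Rᵈ 1F 0F 3F 4F 5F ×ᵈ isOrderedPairᵈ 2F 1F 0F)))
            (i ∷ j ∷ k ∷ a ∷ b ∷ []) (proj₁ c)
      f = proj₁ s

      f-pairs : ∀ p → p ∈ f → ∃[ x ] ∃[ y ] x ∈ a × y ∈ b × IsOrderedPair p x y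
      f-pairs p p∈f = let _ , x , y , x∈a , y∈b , _ , p-pair = to (proj₂ s p) p∈f
                      in x , y , x∈a , y∈b , p-pair

      related⇒R : ∀ {x y} → Related f x y → x ∈ a × R x y i j k
      related⇒R (p , p-pair , p∈f) with to (proj₂ s p) p∈f
      ... | _ , x , y , x∈a , _ , Rxy , p-pair′ with orderedPair-injective p-pair p-pair′
      ...   | refl , refl = x∈a , Rxy

      R⇒related : ∀ {x y} → x ∈ a → R x y i j k → Related f x y
      R⇒related {x} {y} x∈a Rxy =
        let p , p∈c , y′ , Rxy′ , p-pair = proj₂ c x x∈a
            z , z∈b , Rxz = total x∈a
        in p , subst (IsOrderedPair p x) (unique x∈a Rxy′ Rxy) p-pair ,
           from (proj₂ s p) (p∈c , x , y′ , x∈a ,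
             subst (_∈ b) (unique x∈a Rxz Rxy′) z∈b , Rxy′ , p-pair)

      f-total : ∀ x → x ∈ a → ∃[ y ] Related f x y × (∀ y′ → Related f x y′ → y′ ≡ y)
      f-total x x∈a =
        let y , _ , Rxy = total x∈a
        in y , R⇒related x∈a Rxy , λ y′ r → unique x∈a (proj₂ (related⇒R r)) Rxy

  -- Reflection

  Decreasing : M → Set ℓ
  Decreasing f = ∀ x y u v → x ∈ y → Related f x u → Related f y v → v ∈ u

  decreasingᵈ : ∀ {n} i → Definable {n} (λ ρ → Decreasing (lookup ρ i))
  decreasingᵈ i = ∀ᵈ (∀ᵈ (∀ᵈ (∀ᵈ (3F ∈ᵈ 2F →ᵈ relatedᵈ i′ 3F 1F →ᵈ relatedᵈ i′ 2F 0F →ᵈ 0F ∈ᵈ 1F))))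
    where i′ = suc (suc (suc (suc i)))

  -- A decreasing f : n → n extends to n + 1 by adding one to its values and
  -- putting n ↦ 0.
  abstract
    reflection : ∀ {n} → IsNat n → ∃[ f ] IsFunction f n n × Decreasing f
    reflection = ω-induction (∃ᵈ (isFunctionᵈ 0F 1F 1F ×ᵈ decreasingᵈ 0F)) [] base step
      where
      base : ∃[ f ] IsFunction f ∅ ∅ × Decreasing f
      base = ∅ , ((λ p p∈ → contradiction p∈ (∅-empty p)) , λ x x∈ → contradiction x∈ (∅-empty x)) ,
        λ { x y u v x∈y (p , _ , p∈∅) _ → contradiction p∈∅ (∅-empty p) }

      Extension : M → M → M → M → M → Set ℓ
      Extension x y f n _ = (∃[ w ] Related f x w × IsSuc w y) ⊎ x ≡ n × IsEmpty y

      step : ∀ {n} → IsNat n → ∃[ f ] IsFunction f n n × Decreasing f →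
             ∃[ f ] IsFunction f (σ n) (σ n) × Decreasing f
      step {n} nn (f , f-fun , f-dec) =
        let g , g-fun , g-spec = define-function Extension
              (λ x y i j k → ∃ᵈ (relatedᵈ (suc i) (suc x) 0F ×ᵈ isSucᵈ 0F (suc y)) ⊎ᵈ
                             x ≡ᵈ j ×ᵈ isEmptyᵈ y)
              f n ∅ (σ n) (σ n) total unique
        in g , g-fun , λ x y u v x∈y xu yv →
             decreasing x∈y (proj₂ (to g-spec xu)) (proj₂ (to g-spec yv))
        where
        ∅∈σn : ∅ ∈ σ n
        ∅∈σn = ∌⇒∈σ nat-∅ nn (∅-empty n)

        total : ∀ {x} → x ∈ σ n → ∃[ y ] y ∈ σ n × Extension x y f n ∅
        total {x} x∈σn with to (σ-isSuc x) x∈σn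
        ... | inj₂ x≡n = ∅ , ∅∈σn , inj₂ (x≡n , ∅-empty)
        ... | inj₁ x∈n =
          let w , xw = function-value f-fun x∈n
          in σ w , σ-mono nn (proj₂ (function-∈ f-fun xw)) , inj₁ (w , xw , σ-isSuc)

        n∉dom : ∀ {w} → ¬ Related f n w
        n∉dom nw = ∈-irrefl (proj₁ (function-∈ f-fun nw))

        unique : ∀ {x y y′} → x ∈ σ n → Extension x y f n ∅ → Extension x y′ f n ∅ → y ≡ y′
        unique _ (inj₁ (w , xw , y-suc)) (inj₁ (w′ , xw′ , y′-suc))
          with function-unique f-fun xw xw′
        ... | refl = trans (IsSuc⇒≡σ y-suc) (sym (IsSuc⇒≡σ y′-suc))
        unique _ (inj₁ (_ , xw , _)) (inj₂ (refl , _)) = contradiction xw n∉dom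
        unique _ (inj₂ (refl , _)) (inj₁ (_ , xw , _)) = contradiction xw n∉dom
        unique _ (inj₂ (_ , y-empty)) (inj₂ (_ , y′-empty)) =
          trans (IsEmpty⇒≡∅ y-empty) (sym (IsEmpty⇒≡∅ y′-empty))

        f-nat : ∀ {x w} → Related f x w → IsNat w
        f-nat xw = ∈-nat nn (proj₂ (function-∈ f-fun xw))

        decreasing : ∀ {x y u v} → x ∈ y → Extension x u f n ∅ → Extension y v f n ∅ → v ∈ u
        decreasing x∈y (inj₁ (w , xw , u-suc)) (inj₁ (w′ , yw′ , v-suc))
          with IsSuc⇒≡σ u-suc | IsSuc⇒≡σ v-suc
        ... | refl | refl = σ-mono (f-nat xw) (f-dec _ _ _ _ x∈y xw yw′)
        decreasing x∈y (inj₁ (w , xw , u-suc)) (inj₂ (_ , v-empty))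
          with IsSuc⇒≡σ u-suc | IsEmpty⇒≡∅ v-empty
        ... | refl | refl = ∌⇒∈σ nat-∅ (f-nat xw) (∅-empty w)
        decreasing n∈y (inj₂ (refl , _)) (inj₁ (_ , yw , _)) =
          contradiction n∈y (∈-asym (proj₁ (function-∈ f-fun yw)))
        decreasing n∈n (inj₂ (refl , _)) (inj₂ (refl , _)) = contradiction n∈n ∈-irrefl

  -- Interpolation

  Monotone : M → Set ℓ
  Monotone f = ∀ {x y u v} → x ∈ y → Related f x u → Related f y v → ¬ (v ∈ u)

  -- The reasons to cut f before x: the argument is not below c, the value is above v, or the value
  -- drops below an earlier one. Being definable, the condition has a first instance, where `trim`
  -- cuts.
  Obstructs : M → M → M → M → Set ℓ
  Obstructs f c v x = ¬ (x ∈ c) ⊎ ∃[ y ] Related f x y ×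
    (v ∈ y ⊎ ∃[ z ] ∃[ w ] z ∈ x × Related f z w × y ∈ w)

  record Trimmed (f k c v : M) : Set ℓ where
    field
      length  : M
      maximal : length ≡ k ⊎ length ∈ k × Obstructs f c v length
      inside  : ∀ {x} → x ∈ length → x ∈ k
      good    : ∀ {x} → x ∈ length → ¬ Obstructs f c v x

    length-nat : IsNat k → IsNat length
    length-nat nk = [ (λ eq → subst IsNat (sym eq) nk) , ∈-nat nk ∘ proj₁ ]′ maximal

  trim : ∀ f k c v → IsNat k → Trimmed f k c v
  trim f k c v nk with em {P = ∃[ x ] x ∈ k × Obstructs f c v x}
  ... | no none = record
    { length  = k
    ; maximal = inj₁ refl
    ; inside  = id
    ; good    = λ x∈k bad → none (_ , x∈k , bad)
    }
  ... | yes some =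
    let x , x∈k , bad , least = least-∈ obstructsᵈ (f ∷ c ∷ v ∷ []) k some
    in record
    { length  = x
    ; maximal = inj₂ (x∈k , bad)
    ; inside  = λ y∈x → ∈-trans nk y∈x x∈k
    ; good    = λ y∈x → least _ (∈-trans nk y∈x x∈k) y∈x
    }
    where
    obstructsᵈ : Definable {4} (λ ρ → Obstructs (lookup ρ 1F) (lookup ρ 2F) (lookup ρ 3F) (lookup ρ 0F))
    obstructsᵈ = ¬ᵈ (0F ∈ᵈ 2F) ⊎ᵈ ∃ᵈ (relatedᵈ 2F 1F 0F ×ᵈ
      (4F ∈ᵈ 0F ⊎ᵈ ∃ᵈ (∃ᵈ (1F ∈ᵈ 3F ×ᵈ relatedᵈ 4F 1F 0F ×ᵈ 2F ∈ᵈ 0F))))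

  -- Nodes of n^{<n} that take a prescribed value at their last argument.

  module Tree (n : M) (n-nat : IsNat n) where
    module T = Poset (SequenceTree n)

    Reaches : M → M → T.Carrier → Set ℓ
    Reaches a a′ (f , k , _) = k ≡ σ a × Monotone f × Related f a a′

    root : ¬ IsEmpty n → T.Carrier
    root n≢∅ = ∅ , ∅ ,
      [ (λ n≡∅ → contradiction (subst IsEmpty (sym n≡∅) ∅-empty) n≢∅) , id ]′ (∅-minimum n-nat) ,
      (λ p p∈ → contradiction p∈ (∅-empty p)) , λ x x∈ → contradiction x∈ (∅-empty x)

    root-minimum : ∀ n≢∅ s → root n≢∅ T.≤ s
    root-minimum _ _ z z∈∅ = contradiction z∈∅ (∅-empty z)

    value-nat : (s : T.Carrier) → ∀ {x y} → Related (proj₁ s) x y → IsNat y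
    value-nat (_ , _ , _ , f-fun) xy = ∈-nat n-nat (proj₂ (function-∈ f-fun xy))

    reaches-bound : ∀ {a a′} s → Reaches a a′ s → ∀ {x y} → Related (proj₁ s) x y → ¬ (a′ ∈ y)
    reaches-bound {a} s@(_ , _ , _ , f-fun) (refl , mono , aa′) {x} xy a′∈y
      with to (σ-isSuc x) (proj₁ (function-∈ f-fun xy))
    ... | inj₁ x∈a  = mono x∈a xy aa′ a′∈y
    ... | inj₂ refl = ∈-irrefl (subst (_ ∈_) (function-unique f-fun xy aa′) a′∈y)

    -- Up to the argument a, u agrees with s, which is monotone with values at most a′. As a is
    -- below c and a′ is below v, nothing obstructs there, so the cut comes after a.
    trim-contains : ∀ {a a′ c v} s u → IsNat c → Reaches a a′ s → s T.≤ u → a ∈ c → a′ ∈ v →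
                    (t : Trimmed (proj₁ u) (proj₁ (proj₂ u)) c v) → a ∈ Trimmed.length t
    trim-contains {a} {a′} {c} {v} s@(f , .(σ a) , σa∈n , f-fun) u@(g , k , k∈n , g-fun) nc
                  s-reaches@(refl , mono , aa′) s≤u a∈c a′∈v t =
      ¬¬-elim λ a∉ → absurd (∌⇒∈σ (length-nat (∈-nat n-nat k∈n)) na a∉)
      where
      open Trimmed t
      nσa = ∈-nat n-nat σa∈n
      na = ∈-nat nσa ∈σ

      f⇒g : ∀ {x y} → Related f x y → Related g x y
      f⇒g = ⊆⇒related s≤u

      g⇒f : ∀ {x y} → x ∈ σ a → Related g x y → Related f x y
      g⇒f x∈σa xy = let z , xz = function-value f-fun x∈σa
                    in subst (Related f _) (function-unique g-fun (f⇒g xz) xy) xz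

      absurd : ¬ (length ∈ σ a)
      absurd l∈σa with maximal
      ... | inj₁ l≡k = ∈σ⇒∌ l∈σa (subst (a ∈_) (sym l≡k) (proj₁ (function-∈ g-fun (f⇒g aa′))))
      ... | inj₂ (_ , inj₁ l∉c) = l∉c (∉-∈-trans (∈-nat nσa l∈σa) na nc (∈σ⇒∌ l∈σa) a∈c)
      ... | inj₂ (_ , inj₂ (y , ly , inj₁ v∈y)) =
        reaches-bound s s-reaches (g⇒f l∈σa ly) (∈-trans (value-nat u ly) a′∈v v∈y)
      ... | inj₂ (_ , inj₂ (y , ly , inj₂ (z , w , z∈l , zw , y∈w))) =
        mono z∈l (g⇒f (∈-trans nσa z∈l l∈σa) zw) (g⇒f l∈σa ly) y∈w

    -- What survives trimming is monotone with values at most a′, so continuing it by the constant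
    -- a′ keeps it monotone. The trimmed part has length at most a, so the argument a itself
    -- receives the value a′.
    extend-to : ∀ {a a′} (u : T.Carrier) → σ a ∈ n → a′ ∈ n →
                (t : Trimmed (proj₁ u) (proj₁ (proj₂ u)) a a′) →
                ∃[ s ] Reaches a a′ s ×
                  (∀ {x y} → x ∈ Trimmed.length t → Related (proj₁ u) x y → Related (proj₁ s) x y)
    extend-to {a} {a′} u@(g , k , k∈n , g-fun) σa∈n a′∈n t =
      let f , f-fun , f-spec = define-function Continuation
            (λ x y i j k → x ∈ᵈ j ×ᵈ relatedᵈ i x y ⊎ᵈ ¬ᵈ (x ∈ᵈ j) ×ᵈ y ≡ᵈ k)
            g length a′ (σ a) n total unique
      in (f , σ a , σa∈n , f-fun) ,
         (refl ,
          (λ x∈y xu yv → monotone x∈y (proj₂ (to f-spec xu)) (proj₂ (to f-spec yv))) ,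
          from f-spec (∈σ , inj₂ ((λ a∈l → ∈-irrefl (length⊆a a∈l)) , refl))) ,
         λ x∈l xy → from f-spec (∈⇒∈σ (length⊆a x∈l) , inj₁ (x∈l , xy))
      where
      open Trimmed t

      Continuation : M → M → M → M → M → Set ℓ
      Continuation x y g l a′ = x ∈ l × Related g x y ⊎ ¬ (x ∈ l) × y ≡ a′

      length⊆a : ∀ {x} → x ∈ length → x ∈ a
      length⊆a x∈l = ¬¬-elim (good x∈l ∘ inj₁)

      total : ∀ {x} → x ∈ σ a → ∃[ y ] y ∈ n × Continuation x y g length a′
      total {x} _ with em {P = x ∈ length}
      ... | no  x∉l = a′ , a′∈n , inj₂ (x∉l , refl)
      ... | yes x∈l = let y , xy = function-value g-fun (inside x∈l)
                      in y , proj₂ (function-∈ g-fun xy) , inj₁ (x∈l , xy)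

      unique : ∀ {x y y′} → x ∈ σ a → Continuation x y g length a′ →
               Continuation x y′ g length a′ → y ≡ y′
      unique _ (inj₁ (_ , xy))    (inj₁ (_ , xy′))    = function-unique g-fun xy xy′
      unique _ (inj₁ (x∈l , _))   (inj₂ (x∉l , _))    = contradiction x∈l x∉l
      unique _ (inj₂ (x∉l , _))   (inj₁ (x∈l , _))    = contradiction x∈l x∉l
      unique _ (inj₂ (_ , y≡a′))  (inj₂ (_ , y′≡a′))  = trans y≡a′ (sym y′≡a′)

      monotone : ∀ {x y u v} → x ∈ y → Continuation x u g length a′ →
                 Continuation y v g length a′ → ¬ (v ∈ u)
      monotone x∈y (inj₁ (_ , xu)) (inj₁ (y∈l , yv)) v∈u =
        good y∈l (inj₂ (_ , yv , inj₂ (_ , _ , x∈y , xu , v∈u)))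
      monotone x∈y (inj₁ (x∈l , xu)) (inj₂ (_ , refl)) a′∈u = good x∈l (inj₂ (_ , xu , inj₁ a′∈u))
      monotone x∈y (inj₂ (x∉l , _)) (inj₁ (y∈l , _)) _ =
        x∉l (∈-trans (length-nat (∈-nat n-nat k∈n)) x∈y y∈l)
      monotone x∈y (inj₂ (_ , refl)) (inj₂ (_ , refl)) = ∈-irrefl

  -- Interpolation between increasing sequences.

  IncreasingSequence : Cardinal ℓ → Set ℓ
  IncreasingSequence κ =
    Σ[ a ∈ (Cardinal.Carrier κ → ω̂) ] WellOrder.Increasing (wellOrderOf κ) _<̂_ a

  -- `f` may be defined beyond `k`; it is monotone only as far as `k`, a number of the model above
  -- all the a_α.
  record Interpolant {I : Set ℓ} (a a′ : I → ω̂) : Set ℓ where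
    field
      f k        : M
      k-nat      : IsNat k
      value      : ∀ {x} → x ∈ k → ∃ (Related f x)
      value-nat  : ∀ {x y} → Related f x y → IsNat y
      unique     : ∀ {x y y′} → Related f x y → Related f x y′ → y ≡ y′
      monotone   : ∀ {x y u v} → y ∈ k → x ∈ y → Related f x u → Related f y v → ¬ (v ∈ u)
      a∈k        : ∀ α → proj₁ (a α) ∈ k
      f[a]≡a′    : ∀ α → Related f (proj₁ (a α)) (proj₁ (a′ α))

  -- The form in which κ < 𝔱 enters. `D` is a segment of κ during the recursion and all of κ at the
  -- end.
  ChainsBounded : Cardinal ℓ → Set (lsuc ℓ)
  ChainsBounded κ = ∀ n → IsNat n → ¬ IsEmpty n →
    let open Poset (SequenceTree n) renaming (Carrier to T) in
    (D : Cardinal.Carrier κ → Set ℓ) (s : Cardinal.Carrier κ → T) →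
    (∀ {α β} → D α → D β → s α ≤ s β ⊎ s β ≤ s α) → ∃[ u ] (∀ {α} → D α → s α ≤ u)

  -- Outside `D` the nodes are replaced by the root, which is comparable with everything. If the
  -- resulting chain were unbounded, tree-tops of this tree would exist and be at most κ, and hence
  -- 𝔱 would be at most κ.
  chainsBounded : ∀ {𝔱 κ} → Is𝔱 𝔱 → κ <ᶜ 𝔱 → ChainsBounded κ
  chainsBounded {κ = κ} is𝔱 (_ , 𝔱≰κ) n n-nat n≢∅ D s chain =
    let u , s≤u = bounded in u , λ {α} Dα → subst (T._≤ u) (s′-≡ Dα) (s≤u α)
    where
    open Tree n n-nat

    s′ : Cardinal.Carrier κ → T.Carrier
    s′ α with em {P = D α}
    ... | yes _ = s α
    ... | no  _ = root n≢∅

    s′-≡ : ∀ {α} → D α → s′ α ≡ s α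
    s′-≡ {α} Dα with em {P = D α}
    ... | yes _  = refl
    ... | no ¬Dα = contradiction Dα ¬Dα

    s′-cases : ∀ α → D α × s′ α ≡ s α ⊎ s′ α ≡ root n≢∅
    s′-cases α with em {P = D α}
    ... | yes Dα = inj₁ (Dα , refl)
    ... | no  _  = inj₂ refl

    s′-chain : ∀ α β → s′ α T.≤ s′ β ⊎ s′ β T.≤ s′ α
    s′-chain α β with s′-cases α | s′-cases β
    ... | inj₂ eq | _ = inj₁ (subst (T._≤ s′ β) (sym eq) (root-minimum n≢∅ (s′ β)))
    ... | _ | inj₂ eq = inj₂ (subst (T._≤ s′ α) (sym eq) (root-minimum n≢∅ (s′ α)))
    ... | inj₁ (Dα , eq) | inj₁ (Dβ , eq′) = Sum.map
      (subst₂ T._≤_ (sym eq) (sym eq′)) (subst₂ T._≤_ (sym eq′) (sym eq)) (chain Dα Dβ)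

    bounded : ∃[ u ] (∀ α → s′ α T.≤ u)
    bounded = ¬¬-elim λ unb →
      let θ , _ , θ≤κ , tops = Cofinality.treeTops (SequenceTree n) (root n≢∅)
                                 (wellOrderOf κ) {s′} (s′-chain , unb)
      in 𝔱≰κ (θ≤κ ↣-∘ proj₂ is𝔱 θ (n , n-nat , n≢∅ , tops))

  upper-bound : (b b′ : ω̂) → ∃[ m ] IsNat m × (∀ {x} → x ∈ proj₁ b ⊎ x ∈ proj₁ b′ → x ∈ m)
  upper-bound (b , nb) (b′ , nb′) with trichotomy nb nb′
  ... | less b∈b′    = b′ , nb′ , [ (λ x∈b → ∈-trans nb′ x∈b b∈b′) , id ]′
  ... | equal refl   = b , nb , [ id , id ]′
  ... | greater b′∈b = b , nb , [ id , (λ x∈b′ → ∈-trans nb x∈b′ b′∈b) ]′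

  module _ {κ : Cardinal ℓ} (bounded : ChainsBounded κ) (A A′ : IncreasingSequence κ)
           (n : M) (n-nat : IsNat n) (n≢∅ : ¬ IsEmpty n) where
    private
      module κ = WellOrder (wellOrderOf κ)
      a a′ : κ.Carrier → M
      a  = proj₁ ∘ proj₁ A
      a′ = proj₁ ∘ proj₁ A′

    module _ (σa∈n : ∀ α → σ (a α) ∈ n) (a′∈n : ∀ α → a′ α ∈ n) where
      private
        open Tree n n-nat

        Step : ∀ α → (∀ β → β κ.< α → T.Carrier) → T.Carrier → Set ℓ
        Step α prev s = Reaches (a α) (a′ α) s × (∀ β (β<α : β κ.< α) → prev β β<α T.≤ s)

        recursive : Σ[ s ∈ (κ.Carrier → T.Carrier) ]
          (∀ α → ∃ (Step α (λ β _ → s β)) → Step α (λ β _ → s β) (s α))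
        recursive = κ.recursion (root n≢∅) Step

        s : κ.Carrier → T.Carrier
        s = proj₁ recursive

        step : ∀ α → Step α (λ β _ → s β) (s α)
        step = κ.induction _ λ α IH → proj₂ recursive α (exists α IH)
          where
          exists : ∀ α → (∀ β → β κ.< α → Step β (λ γ _ → s γ) (s β)) →
                   ∃ (Step α (λ β _ → s β))
          exists α IH = proj₁ extended , proj₁ (proj₂ extended) , below
            where
            bound = bounded n n-nat n≢∅ (κ._< α) s
              (κ.monotone⇒comparable T._≤_ (λ {t} → T.refl {t}) {κ._< α} {s}
                λ {β} {γ} γ<α → proj₂ (IH γ γ<α) β)
            u = proj₁ bound

            s≤u : ∀ β → β κ.< α → s β T.≤ u
            s≤u β β<α = proj₂ bound {β} β<α

            trimmed = trim (proj₁ u) (proj₁ (proj₂ u)) (a α) (a′ α)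
                           (∈-nat n-nat (proj₁ (proj₂ (proj₂ u))))
            extended = extend-to u (σa∈n α) (a′∈n α) trimmed

            -- The domain of `s β` is a_β + 1. Trimming keeps a_β and thus all smaller arguments, so
            -- `s β` survives whole.
            below : ∀ β → β κ.< α → s β T.≤ proj₁ extended
            below β β<α = function-⊆ (proj₂ (proj₂ (proj₂ (s β)))) λ xy →
              proj₂ (proj₂ extended) (x∈length xy) (⊆⇒related (s≤u β β<α) xy)
              where
              a∈length = trim-contains (s β) u (proj₂ (proj₁ A α)) (proj₁ (IH β β<α))
                           (s≤u β β<α) (proj₂ A β<α) (proj₂ A′ β<α) trimmed

              x∈length : ∀ {x y} → Related (proj₁ (s β)) x y → x ∈ Trimmed.length trimmed
              x∈length {x} xy =
                let x∈dom = proj₁ (function-∈ (proj₂ (proj₂ (proj₂ (s β)))) xy)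
                    x∈σa  = subst (x ∈_) (proj₁ (proj₁ (IH β β<α))) x∈dom
                    nl    = Trimmed.length-nat trimmed (∈-nat n-nat (proj₁ (proj₂ (proj₂ u))))
                in [ (λ x∈a → ∈-trans nl x∈a a∈length)
                   , (λ { refl → a∈length })
                   ]′ (to (σ-isSuc x) x∈σa)

      interpolate : (∀ α → a α ∈ n) → Interpolant (proj₁ A) (proj₁ A′)
      interpolate a∈n = record
        { f         = f
        ; k         = length
        ; k-nat     = length-nat k-nat
        ; value     = λ x∈l → function-value f-fun (inside x∈l)
        ; value-nat = value-nat u
        ; unique    = function-unique f-fun
        ; monotone  = λ y∈l x∈y xu yv v∈u →
            good y∈l (inj₂ (_ , yv , inj₂ (_ , _ , x∈y , xu , v∈u)))
        ; a∈k       = λ α → trim-contains (s α) u n-nat (proj₁ (step α)) (s≤u α)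
                              (a∈n α) (a′∈n α) trimmed
        ; f[a]≡a′   = λ α → ⊆⇒related (s≤u α) (proj₂ (proj₂ (proj₁ (step α))))
        }
        where
        bound = bounded n n-nat n≢∅ (λ _ → ⊤) s
          (κ.monotone⇒comparable T._≤_ (λ {t} → T.refl {t}) {λ _ → ⊤} {s}
            λ {α} {β} _ → proj₂ (step β) α)
        u = proj₁ bound

        s≤u : ∀ α → s α T.≤ u
        s≤u α = proj₂ bound {α} tt

        f = proj₁ u
        f-fun = proj₂ (proj₂ (proj₂ u))
        k-nat = ∈-nat n-nat (proj₁ (proj₂ (proj₂ u)))
        -- Arguments and values of a node are all below n, so with both bounds equal to n the cut
        -- can only be at a failure of monotonicity.
        trimmed = trim f (proj₁ (proj₂ u)) n n k-nat
        open Trimmed trimmed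

  sequence-interpolant : ∀ κ → ChainsBounded κ → (A A′ : IncreasingSequence κ) (b b′ : ω̂) →
                         (∀ α → proj₁ A α <̂ b) → (∀ α → proj₁ A′ α <̂ b′) →
                         Interpolant (proj₁ A) (proj₁ A′)
  sequence-interpolant κ bounded A A′ b b′ a<b a′<b′ =
    let m , m-nat , below = upper-bound b b′
    in interpolate {κ} bounded A A′ (σ (σ m)) (nat-σ (nat-σ m-nat)) (λ empty → empty (σ m) ∈σ)
         (λ α → ∈⇒∈σ (σ-mono m-nat (below (inj₁ (a<b α)))))
         (λ α → ∈⇒∈σ (∈⇒∈σ (below (inj₂ (a′<b′ α)))))
         (λ α → ∈⇒∈σ (∈⇒∈σ (below (inj₁ (a<b α)))))

  -- Uniqueness of the coinitiality

  IsUpperBound : {I : Set ℓ} → (I → ω̂) → M → Set ℓ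
  IsUpperBound a x = ∀ α → proj₁ (a α) ∈ x

  module _ (κ : Cardinal ℓ) (κ-reg : InfiniteRegular κ) where

    -- Every a_α lies below some later a_α′, which is at most p; so p is still a strict bound. In
    -- particular the upper bounds have no least element.
    upperBound-predecessor : (A : IncreasingSequence κ) → ∀ {x} → IsNat x → IsUpperBound (proj₁ A) x →
                             ∃[ p ] IsNat p × x ≡ σ p × IsUpperBound (proj₁ A) p
    upperBound-predecessor (a , a-inc) {x} nx bound
      with predecessor nx (bound (element κ (proj₁ κ-reg)))
    ... | p , np , refl = p , np , refl , λ α →
      let α′ , α<α′ = regular⇒no-maximum κ κ-reg α
      in ∈-∉-trans (proj₂ (a α′)) np (a-inc α<α′) (∈σ⇒∌ (bound α′))

    module _ (A A′ : IncreasingSequence κ) (I : Interpolant (proj₁ A) (proj₁ A′)) where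
      open Interpolant I
      private
        a a′ : Cardinal.Carrier κ → M
        a  = proj₁ ∘ proj₁ A
        a′ = proj₁ ∘ proj₁ A′

      f[a]-≤ : ∀ α {x u} → IsNat x → x ∈ σ (a α) → Related f x u → ¬ (a′ α ∈ u)
      f[a]-≤ α {x} nx x∈σa xu a′∈u with to (σ-isSuc x) x∈σa
      ... | inj₁ x∈a  = monotone (a∈k α) x∈a xu (f[a]≡a′ α) a′∈u
      ... | inj₂ refl = ∈-irrefl (subst (a′ α ∈_) (unique xu (f[a]≡a′ α)) a′∈u)

      -- The largest x with f(x) ≤ y.
      pull : ∀ {y} → IsNat y → IsUpperBound (proj₁ A′) y →
             ∃[ x ] IsNat x × x ∈ k × IsUpperBound (proj₁ A) x ×
             ∃[ v ] Related f x v × IsNat v × ¬ (y ∈ v)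
      pull {y} ny y-bound =
        let l , l-nat , l-bound , below = limit
            p , np , l≡σp , p-bound = upperBound-predecessor A l-nat l-bound
            p∈k , p-good = below (subst (p ∈_) (sym l≡σp) ∈σ)
            v , pv = value p∈k
        in p , np , p∈k , p-bound , v , pv , value-nat pv , p-good pv
        where
        Exceeds : M → Set ℓ
        Exceeds x = ∃[ v ] Related f x v × y ∈ v

        -- Either the first argument where f exceeds y, or k if there is none. All a_α lie below it
        -- because a′_α is below y; its predecessor is the argument sought.
        limit : ∃[ l ] IsNat l × IsUpperBound (proj₁ A) l ×
                (∀ {x} → x ∈ l → x ∈ k × (∀ {v} → Related f x v → ¬ (y ∈ v)))
        limit with em {P = ∃[ x ] x ∈ k × Exceeds x}
        ... | no none = k , k-nat , a∈k , λ x∈k → x∈k , λ xv y∈v → none (_ , x∈k , _ , xv , y∈v)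
        ... | yes some =
          let x , x∈k , (v , xv , y∈v) , least =
                least-∈ (∃ᵈ (relatedᵈ 2F 1F 0F ×ᵈ 3F ∈ᵈ 0F)) (f ∷ y ∷ []) k some
              nx = ∈-nat k-nat x∈k
          in x , nx ,
             (λ α → ¬¬-elim λ a∉x → f[a]-≤ α nx (∌⇒∈σ nx (proj₂ (proj₁ A α)) a∉x) xv
                                      (∈-trans (value-nat xv) (y-bound α) y∈v)) ,
             λ z∈x → let z∈k = ∈-trans k-nat z∈x x∈k
                     in z∈k , λ zv y∈v → least _ z∈k z∈x (_ , zv , y∈v)

      -- The value of f at the largest x′ ≤ x in its domain.
      push : ∀ {x} → IsNat x → IsUpperBound (proj₁ A) x →
             ∃[ x′ ] IsNat x′ × x′ ∈ k × ¬ (x ∈ x′) ×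
             ∃[ y ] Related f x′ y × IsNat y × IsUpperBound (proj₁ A′) y
      push {x} nx x-bound =
        let x′ , nx′ , x′∈k , x∉x′ , x′-bound = inside
            y , x′y = value x′∈k
        in x′ , nx′ , x′∈k , x∉x′ , y , x′y , value-nat x′y , λ α →
             let α′ , α<α′ = regular⇒no-maximum κ κ-reg α
             in ∈-∉-trans (proj₂ (proj₁ A′ α′)) (value-nat x′y) (proj₂ A′ α<α′)
                  (monotone x′∈k (x′-bound α′) (f[a]≡a′ α′) x′y)
        where
        inside : ∃[ x′ ] IsNat x′ × x′ ∈ k × ¬ (x ∈ x′) × IsUpperBound (proj₁ A) x′
        inside with em {P = x ∈ k}
        ... | yes x∈k = x , nx , x∈k , ∈-irrefl , x-bound
        ... | no  x∉k =
          let p , np , k≡σp , p-bound = upperBound-predecessor A k-nat a∈k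
              p∈k = subst (p ∈_) (sym k≡σp) ∈σ
          in p , np , p∈k , (λ x∈p → x∉k (∈-trans k-nat x∈p p∈k)) , p-bound

      f-≤ : ∀ {x x′ u v} → IsNat x → IsNat x′ → x′ ∈ k → ¬ (x′ ∈ x) →
            Related f x u → Related f x′ v → ¬ (v ∈ u)
      f-≤ nx nx′ x′∈k x′∉x xu x′v v∈u with trichotomy nx nx′
      ... | less x∈x′    = monotone x′∈k x∈x′ xu x′v v∈u
      ... | equal refl   = ∈-irrefl (subst (_ ∈_) (unique xu x′v) v∈u)
      ... | greater x′∈x = x′∉x x′∈x

    -- Moving a member of one upper sequence across by `pull` or `push`, then descending to a member
    -- of the other upper sequence, gives maps between θ and θ′ in both directions. Each is
    -- unbounded, as seen by first moving a given member the opposite way.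
    coinitiality-unique : ChainsBounded κ → ∀ {θ θ′} → InfiniteRegular θ → InfiniteRegular θ′ →
                          Cut _<̂_ κ θ → Cut _<̂_ κ θ′ → θ ≈ᶜ θ′
    coinitiality-unique bounded {θ} {θ′} θ-reg θ′-reg C C′ =
      regular-unbounded⇒≈ θ θ′ θ-reg θ′-reg g g-unbounded h h-unbounded
      where
      module C = Cut C
      module C′ = Cut C′
      module θ = WellOrder (wellOrderOf θ)
      module θ′ = WellOrder (wellOrderOf θ′)

      A A′ : IncreasingSequence κ
      A  = C.lower , C.increasing
      A′ = C′.lower , C′.increasing

      b : θ.Carrier → M
      b = proj₁ ∘ C.upper
      b′ : θ′.Carrier → M
      b′ = proj₁ ∘ C′.upper

      b-nat : ∀ β → IsNat (b β)
      b-nat = proj₂ ∘ C.upper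
      b′-nat : ∀ β → IsNat (b′ β)
      b′-nat = proj₂ ∘ C′.upper

      I : Interpolant (proj₁ A) (proj₁ A′)
      I = sequence-interpolant κ bounded A A′
            (C.upper (element θ (proj₁ θ-reg))) (C′.upper (element θ′ (proj₁ θ′-reg)))
            (λ α → C.separated α _) (λ α → C′.separated α _)
      open Interpolant I

      reach : ∀ {x} → IsNat x → IsUpperBound (proj₁ A) x → ∃[ β ] ¬ (x ∈ b β)
      reach nx bound = ¬∀⇒∃¬ λ x<b → C.unfilled ((_ , nx) , λ α β → bound α , x<b β)

      reach′ : ∀ {y} → IsNat y → IsUpperBound (proj₁ A′) y → ∃[ β ] ¬ (y ∈ b′ β)
      reach′ ny bound = ¬∀⇒∃¬ λ y<b′ → C′.unfilled ((_ , ny) , λ α β → bound α , y<b′ β)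

      pull-b′ : ∀ β → ∃[ x ] IsNat x × x ∈ k × IsUpperBound (proj₁ A) x ×
                      ∃[ v ] Related f x v × IsNat v × ¬ (b′ β ∈ v)
      pull-b′ β = pull A A′ I (b′-nat β) λ α → C′.separated α β

      push-b : ∀ β → ∃[ x ] IsNat x × x ∈ k × ¬ (b β ∈ x) ×
                     ∃[ y ] Related f x y × IsNat y × IsUpperBound (proj₁ A′) y
      push-b β = push A A′ I (b-nat β) λ α → C.separated α β

      reach-pull : ∀ β → ∃[ γ ] ¬ (proj₁ (pull-b′ β) ∈ b γ)
      reach-pull β = let _ , nx , _ , bound , _ = pull-b′ β in reach nx bound

      reach-push : ∀ β → ∃[ γ ] ¬ (proj₁ (proj₂ (proj₂ (proj₂ (proj₂ (push-b β))))) ∈ b′ γ)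
      reach-push β = let _ , _ , _ , _ , _ , _ , ny , bound = push-b β in reach′ ny bound

      g : θ′.Carrier → θ.Carrier
      g = proj₁ ∘ reach-pull

      h : θ.Carrier → θ′.Carrier
      h = proj₁ ∘ reach-push

      g-unbounded : Unbounded θ g
      g-unbounded c =
        let x , nx , x∈k , c∉x , y , xy , ny , y-bound = push-b c
            β , y∉b′β = reach′ ny y-bound
            -- One index beyond β makes b′_γ strictly less than y = f(x), so that f(x₂) < f(x) and
            -- monotonicity gives x₂ < x.
            γ , β<γ = regular⇒no-maximum θ′ θ′-reg β
            x₂ , nx₂ , x₂∈k , _ , v , x₂v , nv , b′γ∉v = pull-b′ γ
            b′γ∈y = ∈-∉-trans (b′-nat β) ny (C′.decreasing β<γ) y∉b′β
            v∈y = ∉-∈-trans nv (b′-nat γ) ny b′γ∉v b′γ∈y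
            x₂∈x = ¬¬-elim λ x₂∉x → f-≤ A A′ I nx nx₂ x₂∈k x₂∉x xy x₂v v∈y
        in γ , λ gγ<c → proj₂ (reach-pull γ)
             (∈-trans (b-nat _) (∈-∉-trans nx (b-nat c) x₂∈x c∉x) (C.decreasing gγ<c))

      h-unbounded : Unbounded θ′ h
      h-unbounded c =
        let x , nx , x∈k , x-bound , v , xv , nv , c∉v = pull-b′ c
            β , x∉bβ = reach nx x-bound
            x′ , nx′ , x′∈k , bβ∉x′ , y , x′y , ny , _ = push-b β
            x∉x′ = λ x∈x′ → x∉bβ (∈-∉-trans nx′ (b-nat β) x∈x′ bβ∉x′)
            v∉y = f-≤ A A′ I nx′ nx x∈k x∉x′ x′y xv
            c∉y = λ c∈y → c∉v (∈-∉-trans ny nv c∈y v∉y)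
        in β , λ hβ<c → proj₂ (reach-push β)
             (∉-∈-trans ny (b′-nat c) (b′-nat _) c∉y (C′.decreasing hβ<c))

  -- Existence of cuts

  -- The upper bounds in reverse order form a chain with no bound, as none of them is least.
  -- Zermelo's theorem well-orders them, and `treeTops` extracts a regular coinitial sequence, which
  -- is the upper half of the cut.
  coinitiality : ∀ κ → InfiniteRegular κ → ((a , _) : IncreasingSequence κ) →
                 ∃[ b ] IsNat b × IsUpperBound a b → ∃ (𝒞 κ)
  coinitiality κ κ-reg A@(a , a-inc) (b , b-nat , b-bound) =
    let θ , θ-reg , _ , (s , s-inc , s-unb) , _ =
          Cofinality.treeTops P (b , b-nat , b-bound)
            (Zermelo.wellOrder UpperBound (b , b-nat , b-bound)) {id} (chain , unbounded)
    in θ , κ-reg , θ-reg , record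
      { lower      = a
      ; upper      = λ β → let x , nx , _ = s β in x , nx
      ; increasing = a-inc
      ; decreasing = λ {β} {β′} β<β′ → strict (s β) (s β′) (s-inc β<β′)
      ; separated  = λ α β → proj₂ (proj₂ (s β)) α
      ; unfilled   = λ ((c , nc) , fills) → s-unb
          ( (c , nc , λ α → proj₁ (fills α (element θ (proj₁ θ-reg))))
          , λ β → ∈⇒⊆ (proj₁ (proj₂ (s β))) (proj₂ (fills (element κ (proj₁ κ-reg)) β)) )
      }
    where
    UpperBound : Set ℓ
    UpperBound = ∃[ x ] IsNat x × IsUpperBound a x

    P : Poset ℓ ℓ ℓ
    P = On.poset {B = UpperBound} (Flip.poset inclusion) proj₁

    module P = Poset P

    chain : ∀ x y → x P.≤ y ⊎ y P.≤ x
    chain (x , nx , _) (y , ny , _) with trichotomy nx ny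
    ... | less x∈y    = inj₂ (∈⇒⊆ ny x∈y)
    ... | equal refl  = inj₁ (λ _ → id)
    ... | greater y∈x = inj₁ (∈⇒⊆ nx y∈x)

    unbounded : ¬ (∃[ u ] (∀ x → x P.≤ u))
    unbounded ((u , nu , u-bound) , ≤u) =
      let p , np , u≡σp , p-bound = upperBound-predecessor κ κ-reg A nu u-bound
      in ∈-irrefl (≤u (p , np , p-bound) p (subst (p ∈_) (sym u≡σp) ∈σ))

    strict : ∀ ((x , _) (y , _) : UpperBound) → y ⊆ x × ¬ (x ≡ y) → y ∈ x
    strict (x , nx , _) (y , ny , _) (y⊆x , x≢y) with trichotomy nx ny
    ... | less x∈y    = contradiction x∈y (⊆⇒∌ y⊆x)
    ... | equal x≡y   = contradiction x≡y x≢y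
    ... | greater y∈x = y∈x

  -- Restricted along an embedding of κ into κ₀, the lower half is still bounded, by any member of
  -- the old upper half; a new upper half comes from `coinitiality`.
  cut-≤ : ∀ {κ κ₀ θ₀} → InfiniteRegular κ → κ ≤ᶜ κ₀ → 𝒞 κ₀ θ₀ → ∃ (𝒞 κ)
  cut-≤ {κ} {κ₀} {θ₀} κ-reg κ≤κ₀ (κ₀-reg , θ₀-reg , C) =
    let e , e-inc , _ = ≤⇒initialEmbedding κ κ₀ (proj₁ κ₀-reg) κ≤κ₀
        b , nb = C.upper (element θ₀ (proj₁ θ₀-reg))
    in coinitiality κ κ-reg (C.lower ∘ e , C.increasing ∘ e-inc)
         (b , nb , λ α → C.separated (e α) _)
    where module C = Cut C

  reflect : ∀ {κ θ} → 𝒞 κ θ → 𝒞 θ κ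
  reflect {κ} {θ} (κ-reg , θ-reg , C) = θ-reg , κ-reg , record
    { lower      = λ β → image (b∈n β)
    ; upper      = λ α → image (a∈n α)
    ; increasing = λ {β} {β′} β<β′ → image-decreasing (b∈n β′) (b∈n β) (C.decreasing β<β′)
    ; decreasing = λ {α} {α′} α<α′ → image-decreasing (a∈n α) (a∈n α′) (C.increasing α<α′)
    ; separated  = λ β α → image-decreasing (a∈n α) (b∈n β) (C.separated α β)
    ; unfilled   = λ (c , fills) → C.unfilled (preimage c λ β α → fills β α)
    }
    where
    module C = Cut C
    module θ = WellOrder (wellOrderOf θ)

    -- The first index carries the largest member of the upper half, so its successor n lies above
    -- both halves of the cut.
    β₀ = proj₁ (θ.minimal (λ _ → ⊤ {ℓ}) (element θ (proj₁ θ-reg) , tt))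
    β₀-min = proj₂ (proj₂ (θ.minimal (λ _ → ⊤ {ℓ}) (element θ (proj₁ θ-reg) , tt)))

    n : M
    n = σ (proj₁ (C.upper β₀))

    n-nat : IsNat n
    n-nat = nat-σ (proj₂ (C.upper β₀))

    b∈n : ∀ β → proj₁ (C.upper β) ∈ n
    b∈n β with θ.compare β β₀
    ... | tri< β<β₀ _ _ = contradiction tt (β₀-min β β<β₀)
    ... | tri≈ _ refl _ = ∈σ
    ... | tri> _ _ β₀<β = ∈⇒∈σ (C.decreasing β₀<β)

    a∈n : ∀ α → proj₁ (C.lower α) ∈ n
    a∈n α = ∈⇒∈σ (C.separated α β₀)

    f = proj₁ (reflection n-nat)
    f-fun = proj₁ (proj₂ (reflection n-nat))
    f-dec = proj₂ (proj₂ (reflection n-nat))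

    image : ∀ {x} → x ∈ n → ω̂
    image x∈n = let y , xy = function-value f-fun x∈n
                in y , ∈-nat n-nat (proj₂ (function-∈ f-fun xy))

    image-spec : ∀ {x} (x∈n : x ∈ n) → Related f x (proj₁ (image x∈n))
    image-spec x∈n = proj₂ (function-value f-fun x∈n)

    image-decreasing : ∀ {x y} (x∈n : x ∈ n) (y∈n : y ∈ n) → x ∈ y → image y∈n <̂ image x∈n
    image-decreasing x∈n y∈n x∈y = f-dec _ _ _ _ x∈y (image-spec x∈n) (image-spec y∈n)

    -- The least x with f(x) ≤ c.
    preimage : ∀ c → (∀ β α → (image (b∈n β) <̂ c) × (c <̂ image (a∈n α))) →
               ∃[ x ] (∀ α β → (C.lower α <̂ x) × (x <̂ C.upper β))
    preimage (c , nc) fills =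
      let x , x∈n , (v , xv , c∉v) , least =
            least-∈ (∃ᵈ (relatedᵈ 2F 1F 0F ×ᵈ ¬ᵈ (3F ∈ᵈ 0F))) (f ∷ c ∷ []) n
              (_ , b∈n β₀ , _ , image-spec (b∈n β₀) , below β₀)
          nx = ∈-nat n-nat x∈n
      in (x , nx) , λ α β →
           ¬¬-elim (λ a∉x → c∉v (above xv nx (∌⇒∈σ nx (proj₂ (C.lower α)) a∉x))) ,
           -- Leastness only gives x ≤ b_β′; going one index beyond β makes x strictly less than
           -- b_β.
           (let β′ , β<β′ = regular⇒no-maximum θ θ-reg β
            in ∉-∈-trans nx (proj₂ (C.upper β′)) (proj₂ (C.upper β))
                 (λ b∈x → least _ (b∈n β′) b∈x (_ , image-spec (b∈n β′) , below β′))
                 (C.decreasing β<β′))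
      where
      α₀ = element κ (proj₁ κ-reg)

      below : ∀ β → ¬ (c ∈ proj₁ (image (b∈n β)))
      below β = ∈-asym (proj₁ (fills β α₀))

      above : ∀ {α x v} → Related f x v → IsNat x → x ∈ σ (proj₁ (C.lower α)) → c ∈ v
      above {α} {x} xv nx x∈σa with to (σ-isSuc x) x∈σa
      ... | inj₂ refl = subst (c ∈_) (function-unique f-fun (image-spec (a∈n α)) xv)
                              (proj₂ (fills β₀ α))
      ... | inj₁ x∈a  = ∈-trans (∈-nat n-nat (proj₂ (function-∈ f-fun xv)))
                          (proj₂ (fills β₀ α)) (f-dec _ _ _ _ x∈a xv (image-spec (a∈n α)))

  <successor⇒≤ : ∀ (κ μ μ⁺ : Cardinal ℓ) → Infinite μ → IsSuccessor μ μ⁺ → κ <ᶜ μ⁺ → κ ≤ᶜ μ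
  <successor⇒≤ κ μ μ⁺ μ-inf (_ , least) (_ , μ⁺≰κ) =
    ¬¬-elim λ κ≰μ → [ κ≰μ , (λ μ≤κ → μ⁺≰κ (least κ (μ≤κ , κ≰μ))) ]′ (≤ᶜ-total κ μ μ-inf)

mainTheorem5 : EM → FunExt →
    ∀ {ℓ} (V̂ : ModelZFC⁻ ℓ) → let open ModelZFC⁻ V̂ in
    ωNonstandard →
    ∀ (𝔭 𝔭⁺ 𝔱 : Cardinal ℓ) → Is𝔭 𝔭 → IsSuccessor 𝔭 𝔭⁺ → Is𝔱 𝔱 →
    ∀ (κ : Cardinal ℓ) → InfiniteRegular κ → κ <ᶜ 𝔭⁺ → κ <ᶜ 𝔱 →
    ∃[ θ ] 𝒞 κ θ × (∀ θ′ → 𝒞 κ θ′ → θ′ ≈ᶜ θ) × 𝒞 θ κ × (∀ θ′ → 𝒞 θ′ κ → θ′ ≈ᶜ θ)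
mainTheorem5 em fe V̂ _ 𝔭 𝔭⁺ 𝔱 ((κ₀ , θ₀ , C₀ , 𝔭↔κ₀+θ₀) , _) is𝔭⁺ is𝔱 κ κ-reg κ<𝔭⁺ κ<𝔱 =
  θ , C , unique , reflect C , λ θ′ → unique θ′ ∘ reflect
  where
  open ModelZFC⁻ V̂
  open Classical em fe
  open Model em fe V̂

  κ₀-infinite = proj₁ (proj₁ C₀)

  𝔭-infinite : Infinite 𝔭
  𝔭-infinite = ↔⇒↣ (↔-sym 𝔭↔κ₀+θ₀) ↣-∘ (mk↣ inj₁-injective ↣-∘ κ₀-infinite)

  κ≤κ₀+θ₀ = ↔⇒↣ 𝔭↔κ₀+θ₀ ↣-∘ <successor⇒≤ κ 𝔭 𝔭⁺ 𝔭-infinite is𝔭⁺ κ<𝔭⁺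

  cut : ∃ (𝒞 κ)
  cut = [ (λ κ≤κ₀ → cut-≤ κ-reg κ≤κ₀ C₀)
        , (λ κ≤θ₀ → cut-≤ κ-reg κ≤θ₀ (reflect C₀))
        ]′ (regular-≤-⊎ κ κ-reg κ≤κ₀+θ₀)

  θ = proj₁ cut
  C = proj₂ cut

  unique : ∀ θ′ → 𝒞 κ θ′ → θ′ ≈ᶜ θ
  unique θ′ (_ , θ′-reg , C′) = let _ , θ-reg , cut = C in
    coinitiality-unique κ κ-reg (chainsBounded {𝔱} {κ} is𝔱 κ<𝔱) θ′-reg θ-reg C′ cut
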